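{- Let $f\ge2$ be an integer and $l$ an odd prime with $l\equiv1\pmod f$; write $l=ef+1$. Let $K$ be a field with $\operatorname{char}K\nmid f!$, $\operatorname{char}K\ne l$, and $\operatorname{Gal}(K(\zeta_l)/K)\simeq(\mathbb{Z}/l\mathbb{Z})^\times=\langle\gamma\rangle$ (so $\gamma$ is a generator of $(\mathbb{Z}/l\mathbb{Z})^\times$). Put $\beta=\gamma^e$. For $t\in\mathbb{Z}/l\mathbb{Z}$ set $$T_t({\bf x})=\sum_{\substack{(i_0,\dots,i_{f-1})\in(\mathbb{Z}/l\mathbb{Z})^f\\ i_0+\beta i_1+\cdots+\beta^{f-1}i_{f-1}\equiv t}}x_{i_0}x_{i_1}\cdots x_{i_{f-1}}$$ for ${\bf x}=(x_1,\dots,x_{l-1})$ with the convention $x_0=0$. Let $V\subset K^{l-1}$ be defined by $h_m({\bf x}):=T_{\gamma^m}({\bf x})-T_{\gamma^{m+1}}({\bf x})=0$ for $m=1,\dots,e-1$, and let $h({\bf x}):=T_0({\bf x})-T_{\gamma}({\bf x})$. Then $h$ is a regular $f$-ic form which is multiplicative on $V$, i.e. there exists a bilinear map $\varphi:K^{l-1}\times K^{l-1}\to K^{l-1}$ with $\varphi(V\times V)\subset V$ and $h({\bf x})h({\bf y})=h(\varphi({\bf x},{\bf y}))$ for all ${\bf x},{\bf y}\in V$. Moreover, for each $d\in(\mathbb{Z}/l\mathbb{Z})^\times$ such a map is given by $\varphi_d({\bf x},{\bf y})=(z_{1,d},\dots,z_{l-1,d})$, $$z_{k,d}=(-1)^{f-1}\Big(\sum_{i=1}^{l-1}x_{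 -d^{ -1}i}y_{k-i}-\sum_{i=1}^{l-1}x_{ -d^{ -1}i}y_{ -i}\Big)\quad(k=1,\dots,l-1),$$ subscripts modulo $l$ with $x_0=y_0=0$.
   Context: An $f$-ic form on $K^n$ is a homogeneous polynomial of degree $f$; when $\operatorname{char}K\nmid f!$ it has an associated symmetric $f$-linear form $\theta$ with $h({\bf x})=\theta({\bf x},\dots,{\bf x})$, and $h$ is called regular if $\theta({\bf v}_1,{\bf v}_2,\dots,{\bf v}_f)=0$ for all ${\bf v}_2,\dots,{\bf v}_f\in K^n$ implies ${\bf v}_1=0$. Points of $V$ are its $K$-rational points. -}

module Defs where

open import Level using (Level; _⊔_)
open import Algebra.Bundles using (CommutativeRing)
open import Data.Nat as ℕ using (ℕ; zero; suc; _∸_; _%_; _<_; _≤_)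
open import Data.Nat.Properties using (_≟_; _<?_)
open import Data.Fin as Fin using (Fin; toℕ)
open import Data.Fin.Permutation using (Permutation′; _⟨$⟩ʳ_)
open import Data.Vec.Functional using (_∷_)
open import Data.Product using (Σ; ∃; _×_; _,_)
open import Relation.Nullary using (¬_; yes; no; Dec)
open import Relation.Binary.PropositionalEquality using (_≡_)

negMod : (l : ℕ) → .{{_ : ℕ.NonZero l}} → ℕ → ℕ
negMod l a = (l ∸ (a % l)) % l

IsGeneratorMod : (l γ : ℕ) → .{{_ : ℕ.NonZero l}} → Set
IsGeneratorMod l γ =
  ¬ (γ % l ≡ 0) × (∀ a → 1 ≤ a → a < l → ∃ λ k → (γ ℕ.^ k) % l ≡ a)

module _ {c ℓ : Level} (R : CommutativeRing c ℓ) where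
  open CommutativeRing R hiding (zero)

  IsField : Set (c ⊔ ℓ)
  IsField = ¬ (1# ≈ 0#) × (∀ x → ¬ (x ≈ 0#) → ∃ λ y → x * y ≈ 1#)

  natK : ℕ → Carrier
  natK zero = 0#
  natK (suc m) = 1# + natK m

  CharNotDivides : ℕ → Set ℓ
  CharNotDivides m = ¬ (natK m ≈ 0#)

  powK : Carrier → ℕ → Carrier
  powK a zero = 1#
  powK a (suc m) = a * powK a m

  sumFin : (n : ℕ) → (Fin n → Carrier) → Carrier
  sumFin zero g = 0#
  sumFin (suc n) g = g Fin.zero + sumFin n (λ i → g (Fin.suc i))

  prodFin : (n : ℕ) → (Fin n → Carrier) → Carrier
  prodFin zero g = 1#
  prodFin (suc n) g = g Fin.zero * prodFin n (λ i → g (Fin.suc i))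

  sumTuples : (f l : ℕ) → ((Fin f → Fin l) → Carrier) → Carrier
  sumTuples zero l g = g (λ ())
  sumTuples (suc f) l g = sumFin l (λ a → sumTuples f l (λ is → g (a ∷ is)))

  sumUpTo : ℕ → (ℕ → Carrier) → Carrier
  sumUpTo zero g = g zero
  sumUpTo (suc k) g = sumUpTo k g + g (suc k)

  -- Irreducibility over K of the l-th cyclotomic polynomial
  -- Φ_l = 1 + X + ⋯ + X^{l-1}: it is not a product of two monic polynomials
  -- of positive degrees a, b.  A monic polynomial of degree a is given by
  -- its lower coefficients c : Fin a → K.

  monicCoeff : (a : ℕ) → (Fin a → Carrier) → ℕ → Carrier
  monicCoeff zero c zero = 1#
  monicCoeff zero c (suc i) = 0#
  monicCoeff (suc a) c zero = c Fin.zero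
  monicCoeff (suc a) c (suc i) = monicCoeff a (λ j → c (Fin.suc j)) i

  CyclotomicIrreducible : (l : ℕ) → Set (c ⊔ ℓ)
  CyclotomicIrreducible l =
    ∀ (a b : ℕ) → 1 ≤ a → 1 ≤ b → a ℕ.+ b ≡ l ∸ 1 →
    ∀ (g : Fin a → Carrier) (h : Fin b → Carrier) →
    ¬ (∀ k → k ≤ l ∸ 1 →
         sumUpTo k (λ i → monicCoeff a g i * monicCoeff b h (k ∸ i)) ≈ 1#)

  Vec : ℕ → Set c
  Vec n = Fin n → Carrier

  _≈ᵛ_ : {n : ℕ} → Vec n → Vec n → Set ℓ
  u ≈ᵛ v = ∀ i → u i ≈ v i

  zeroᵛ : {n : ℕ} → Vec n
  zeroᵛ _ = 0#

  axpy : {n : ℕ} → Carrier → Vec n → Vec n → Vec n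
  axpy a u v i = a * u i + v i

  IsBilinear : {n : ℕ} → (Vec n → Vec n → Vec n) → Set (c ⊔ ℓ)
  IsBilinear φ =
    (∀ a x x′ y → φ (axpy a x x′) y ≈ᵛ axpy a (φ x y) (φ x′ y)) ×
    (∀ a x y y′ → φ x (axpy a y y′) ≈ᵛ axpy a (φ x y) (φ x y′))

  update : {n m : ℕ} → (Fin m → Vec n) → Fin m → Vec n → (Fin m → Vec n)
  update v j u k with Fin._≟_ k j
  ... | yes _ = u
  ... | no _ = v k

  IsMultilinear : {n m : ℕ} → ((Fin m → Vec n) → Carrier) → Set (c ⊔ ℓ)
  IsMultilinear {n} {m} θ =
    ∀ (v : Fin m → Vec n) (j : Fin m) (a : Carrier) (u w : Vec n) →
    θ (update v j (axpy a u w)) ≈ a * θ (update v j u) + θ (update v j w)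

  IsSymmetric : {n m : ℕ} → ((Fin m → Vec n) → Carrier) → Set (c ⊔ ℓ)
  IsSymmetric {n} {m} θ =
    ∀ (σ : Permutation′ m) (v : Fin m → Vec n) → θ (λ k → v (σ ⟨$⟩ʳ k)) ≈ θ v

  -- h : K^n → K is a regular form of degree suc m: it is the diagonal of a
  -- symmetric (suc m)-linear form θ (its associated form, unique when
  -- char K ∤ (suc m)!), and θ is nondegenerate.
  IsRegularForm : {n : ℕ} → (m : ℕ) → (Vec n → Carrier) → Set (c ⊔ ℓ)
  IsRegularForm {n} m h =
    Σ ((Fin (suc m) → Vec n) → Carrier) λ θ →
      IsMultilinear θ × IsSymmetric θ ×
      (∀ x → h x ≈ θ (λ _ → x)) ×
      (∀ (u : Vec n) → (∀ (w : Fin m → Vec n) → θ (u ∷ w) ≈ 0#) → u ≈ᵛ zeroᵛ)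

  -- The objects of the theorem.  Points are x = (x₁,…,x_{l-1}) : Vec (l ∸ 1),
  -- where coordinate x_k (1 ≤ k ≤ l-1) is x (k-1).

  getV : (n : ℕ) → Vec n → ℕ → Carrier
  getV zero x i = 0#
  getV (suc n) x zero = x Fin.zero
  getV (suc n) x (suc i) = getV n (λ j → x (Fin.suc j)) i

  -- x_r with subscript r taken modulo l and the convention x₀ = 0
  sub : (l : ℕ) → .{{_ : ℕ.NonZero l}} → Vec (l ∸ 1) → ℕ → Carrier
  sub l x r with r % l
  ... | zero = 0#
  ... | suc i = getV (l ∸ 1) x i

  weightedSum : (f l β : ℕ) → (Fin f → Fin l) → ℕ
  weightedSum zero l β is = 0
  weightedSum (suc f) l β is =
    toℕ (is Fin.zero) ℕ.+ β ℕ.* weightedSum f l β (λ j → is (Fin.suc j))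

  T : (f l β t : ℕ) → .{{_ : ℕ.NonZero l}} → Vec (l ∸ 1) → Carrier
  T f l β t x = sumTuples f l λ is →
    term is (weightedSum f l β is % l ≟ t % l)
    where
    term : (is : Fin f → Fin l) → Dec (weightedSum f l β is % l ≡ t % l) → Carrier
    term is (yes _) = prodFin f (λ j → sub l x (toℕ (is j)))
    term is (no _) = 0#

  phi : (f l dinv : ℕ) → .{{_ : ℕ.NonZero l}} →
        Vec (l ∸ 1) → Vec (l ∸ 1) → Vec (l ∸ 1)
  phi f l dinv x y kk =
    powK (- 1#) (f ∸ 1) *
      (sumFin (l ∸ 1) (λ ii → sub l x (negMod l (dinv ℕ.* i ii))
                                * sub l y (k ℕ.+ negMod l (i ii)))
       - sumFin (l ∸ 1) (λ ii → sub l x (negMod l (dinv ℕ.* i ii))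
                                * sub l y (negMod l (i ii))))
    where
    k : ℕ
    k = suc (toℕ kk)
    i : Fin (l ∸ 1) → ℕ
    i ii = suc (toℕ ii)

  hForm : (f l e γ : ℕ) → .{{_ : ℕ.NonZero l}} → Vec (l ∸ 1) → Carrier
  hForm f l e γ x = T f l (γ ℕ.^ e) 0 x - T f l (γ ℕ.^ e) γ x

  hComp : (f l e γ : ℕ) → .{{_ : ℕ.NonZero l}} → ℕ → Vec (l ∸ 1) → Carrier
  hComp f l e γ m x =
    T f l (γ ℕ.^ e) (γ ℕ.^ m) x - T f l (γ ℕ.^ e) (γ ℕ.^ (m ℕ.+ 1)) x

  InV : (f l e γ : ℕ) → .{{_ : ℕ.NonZero l}} → Vec (l ∸ 1) → Set ℓ
  InV f l e γ x = ∀ m → 1 ≤ m → m < e → hComp f l e γ m x ≈ 0#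

  MultiplicativeVia : (f l e γ : ℕ) → .{{_ : ℕ.NonZero l}} →
    (Vec (l ∸ 1) → Vec (l ∸ 1) → Vec (l ∸ 1)) → Set (c ⊔ ℓ)
  MultiplicativeVia f l e γ φ =
    IsBilinear φ
    × (∀ x y → InV f l e γ x → InV f l e γ y → InV f l e γ (φ x y))
    × (∀ x y → InV f l e γ x → InV f l e γ y →
         hForm f l e γ x * hForm f l e γ y ≈ hForm f l e γ (φ x y))

-- Read x as X = Σ xᵢ ζⁱ in B = K[ζ]/(1 + ζ + ⋯ + ζ^{l-1}), and let σ be the
-- automorphism ζ ↦ ζ^β, of order f.  Then T_t(x) is the coefficient of ζᵗ in the
-- norm N X = X · σX ⋯ σ^{f-1}X.  As N X is fixed by σ, its coefficients are
-- constant along multiplication by β, so x lies on V exactly when N X is a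
-- scalar, and this scalar is h(x).  Since φ_d(x, y) represents ± a Galois
-- conjugate of X times Y, the multiplicativity of h on V is that of N.
--
-- The symmetric form of h is θ(v₁, …, v_f) = λ(perm(σʲ vᵢ)) / f!, where λ is the
-- coefficient at 0 minus the one at γ.  The permanent is linear over the fixed
-- field of σ, so if θ(u, ·) = 0 then every perm(u, w) is annihilated by the trace
-- of 1 - ζ^{-γ} down to that field.  This trace is not zero, and B has no zero
-- divisors because the cyclotomic polynomial is irreducible, so perm(u, w) = 0
-- for all w.  Independence of the characters σʲ, in the explicit form of
-- orthogonality relations, then yields u = 0.
module Submission where

open import Defs
open import Algebra.Bundles using (CommutativeRing)
open import Algebra.Morphism.Structures using (IsRingHomomorphism)
import Algebra.Properties.CommutativeSemigroup as CommSemigroup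
import Algebra.Properties.Group as GroupProperties
import Algebra.Properties.Ring as RingProperties
import Algebra.Properties.Semiring.Mult as SemiringMult
import Algebra.Properties.Semiring.Sum as SemiringSum
import Algebra.Solver.Ring.NaturalCoefficients.Default as SemiringSolver
open import Algebra.Structures using (IsCommutativeRing)
open import Data.Empty using (⊥)
open import Data.Fin as Fin using (Fin; toℕ; fromℕ<; punchIn; punchOut)
open import Data.Fin.Permutation as Perm using (Permutation′; permutation; _⟨$⟩ʳ_)
open import Data.Fin.Properties using (toℕ<n; toℕ-fromℕ<; toℕ-injective; toℕ-inject₁; toℕ-fromℕ; pigeonhole; punchInᵢ≢i; punchIn-punchOut; punchIn-injective)
import Data.List as List
open import Data.Nat as ℕ using (ℕ; zero; suc; z≤n; s≤s; _!; _^_; _∸_)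
open import Data.Nat.DivMod using (m%n<n; m%n≤n; m<n⇒m%n≡m; m≡m%n+[m/n]*n)
open import Data.Nat.Divisibility using (m%n≡0⇒n∣m; n∣m⇒m%n≡0)
open import Data.Nat.Induction using (<-rec)
open import Data.Nat.Primality using (Prime; euclidsLemma)
import Data.Nat.Properties as ℕ
open import Data.Nat.Tactic.RingSolver using (solve-∀)
open import Data.Product using (Σ; ∃; _×_; _,_; proj₁; proj₂)
open import Data.Sum using (_⊎_; inj₁; inj₂)
open import Data.Vec.Functional using (_∷_)
open import Function using (_∘_)
open import Level using (0ℓ; _⊔_)
open import Relation.Binary using (Setoid; IsEquivalence)
open import Relation.Binary.PropositionalEquality as ≡ using (_≡_; _≢_; _≗_)
import Relation.Binary.Reasoning.Setoid as SetoidReasoning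
open import Relation.Nullary using (¬_; yes; no; Dec; contradiction)
open import Relation.Nullary.Decidable using (map′)

-- Equality in K is not assumed decidable, and this shapes the regularity argument. Irreducibility
-- gives only a negative statement, that two elements different from 0 cannot have product 0,
-- whereas u = 0 is a positive one. So every cancellation rests on an inverse in K: of l, of f!, or
-- of the norm down to K of the trace. Independence of the characters likewise becomes a
-- computation. Where that slot is conjugated by σʲ, the factor Σ ζ^{(βʲ-1)i} appears, which is l
-- for j = 0 and 0 for 0 < j < f. This strips off one slot at the price of a factor l; repeated, it
-- leaves u alone. The relation 1 + ζ + ⋯ + ζ^{l-1} = 0 determines coefficients only up to a common
-- constant, so only differences such as T_0 - T_γ are functions on B.

-- Finite sums in a commutative ring.

module FiniteSums {c ℓ} (B : CommutativeRing c ℓ) where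
  open CommutativeRing B hiding (zero)
  open SemiringMult semiring using () renaming (_×_ to _·_)
  private module S = SemiringSum semiring

  -- Opaque, so that unification can read off the summand.
  opaque
    ∑ : ∀ n → (Fin n → Carrier) → Carrier
    ∑ n g = S.sum g

  infixl 10 ∑
  syntax ∑ n (λ i → x) = ∑[ i < n ] x

  opaque
    unfolding ∑

    ∑-zero : ∀ {g : Fin 0 → Carrier} → ∑ 0 g ≡ 0#
    ∑-zero = ≡.refl

    ∑-suc : ∀ {n} {g : Fin (suc n) → Carrier} → ∑ (suc n) g ≡ g Fin.zero + ∑ n (g ∘ Fin.suc)
    ∑-suc = ≡.refl

    ∑-cong : ∀ {n} {g g′ : Fin n → Carrier} → (∀ i → g i ≈ g′ i) → ∑ n g ≈ ∑ n g′
    ∑-cong = S.sum-cong-≋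

    ∑-+ : ∀ {n} {g g′ : Fin n → Carrier} → ∑[ i < n ] (g i + g′ i) ≈ ∑ n g + ∑ n g′
    ∑-+ {n} {g} {g′} = S.∑-distrib-+ {n} g g′

    *-∑ : ∀ {n} x {g : Fin n → Carrier} → x * ∑ n g ≈ ∑[ i < n ] (x * g i)
    *-∑ {n} x {g} = S.*-distribˡ-sum {n} x g

    ∑-* : ∀ {n} x {g : Fin n → Carrier} → ∑ n g * x ≈ ∑[ i < n ] (g i * x)
    ∑-* {n} x {g} = S.*-distribʳ-sum {n} x g

    ∑-comm : ∀ {m n} {g : Fin m → Fin n → Carrier} →
      ∑[ i < m ] ∑[ j < n ] g i j ≈ ∑[ j < n ] ∑[ i < m ] g i j
    ∑-comm {m} {n} {g} = S.∑-comm {m} {n} g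

    ∑-permute : ∀ {n} (π : Permutation′ n) {g : Fin n → Carrier} → ∑ n g ≈ ∑[ i < n ] g (π ⟨$⟩ʳ i)
    ∑-permute π {g} = S.sum-permute g π

    ∑-remove : ∀ {n} (i : Fin (suc n)) {g : Fin (suc n) → Carrier} →
      ∑ (suc n) g ≈ g i + ∑ n (g ∘ punchIn i)
    ∑-remove i {g} = S.sum-remove {i = i} g

    ∑-const : ∀ n {x} → ∑[ i < n ] x ≈ n · x
    ∑-const n = S.sum-replicate n

    ∑-0 : ∀ n → ∑[ i < n ] 0# ≈ 0#
    ∑-0 n = S.sum-replicate-zero n

    ∑-last : ∀ {n} {g : Fin (suc n) → Carrier} →
      ∑ (suc n) g ≈ ∑[ i < n ] g (Fin.inject₁ i) + g (Fin.fromℕ n)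
    ∑-last {n} {g} = S.sum-init-last g

  ∑-single : ∀ {n} (k : Fin n) {g : Fin n → Carrier} → (∀ i → i ≢ k → g i ≈ 0#) → ∑ n g ≈ g k
  ∑-single {suc n} k off = trans (∑-remove k)
    (trans (+-congˡ (trans (∑-cong λ i → off _ (punchInᵢ≢i k i)) (∑-0 n))) (+-identityʳ _))

-- Congruence modulo l and sums over residue classes.

-- The modulus is l = suc r, so that r * a represents -a.
module Residues (r : ℕ) where
  open import Data.Nat using (_+_; _*_; _%_; _<_; _^_)
  open import Data.Nat.Properties
  open import Data.Nat.DivMod
  open import Data.Nat.Tactic.RingSolver using (solve)
  l : ℕ
  l = suc r

  infix 4 _≋_ _≋?_
  -- A record rather than a bare equation of remainders, so that `a` and `b` can be inferred from a
  -- proof of congruence.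
  record _≋_ (a b : ℕ) : Set where
    constructor congruent
    field %-eq : a % l ≡ b % l
  open _≋_ public

  ≋-isEquivalence : IsEquivalence _≋_
  ≋-isEquivalence = record
    { refl = congruent ≡.refl
    ; sym = λ p → congruent (≡.sym (%-eq p))
    ; trans = λ p q → congruent (≡.trans (%-eq p) (%-eq q)) }

  ≋-setoid : Setoid 0ℓ 0ℓ
  ≋-setoid = record { isEquivalence = ≋-isEquivalence }

  open Setoid ≋-setoid public using ()
    renaming (refl to ≋-refl; sym to ≋-sym; trans to ≋-trans; reflexive to ≡⇒≋)
  open SetoidReasoning ≋-setoid

  _≋?_ : ∀ a b → Dec (a ≋ b)
  a ≋? b = map′ congruent %-eq (a % l ≟ b % l)

  +-multiples⇒≋ : ∀ {a b} j k → a + j * suc r ≡ b + k * suc r → a ≋ b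
  +-multiples⇒≋ {a} {b} j k e = congruent
    (≡.trans (≡.sym ([m+kn]%n≡m%n a j l)) (≡.trans (%-congˡ e) ([m+kn]%n≡m%n b k l)))

  %-≋ : ∀ a → a % l ≋ a
  %-≋ a = congruent (m%n%n≡m%n a l)

  ≋⇒≡ : ∀ {a b} → a < l → b < l → a ≋ b → a ≡ b
  ≋⇒≡ a<l b<l e = ≡.trans (≡.sym (m<n⇒m%n≡m a<l)) (≡.trans (%-eq e) (m<n⇒m%n≡m b<l))

  +-≋ : ∀ {a a′ b b′} → a ≋ a′ → b ≋ b′ → a + b ≋ a′ + b′
  +-≋ {a} {a′} {b} {b′} p q = congruent (≡.trans (%-distribˡ-+ a b l)
    (≡.trans (%-congˡ (≡.cong₂ _+_ (%-eq p) (%-eq q))) (≡.sym (%-distribˡ-+ a′ b′ l))))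

  *-≋ : ∀ {a a′ b b′} → a ≋ a′ → b ≋ b′ → a * b ≋ a′ * b′
  *-≋ {a} {a′} {b} {b′} p q = congruent (≡.trans (%-distribˡ-* a b l)
    (≡.trans (%-congˡ (≡.cong₂ _*_ (%-eq p) (%-eq q))) (≡.sym (%-distribˡ-* a′ b′ l))))

  ^-≋ : ∀ {a a′} n → a ≋ a′ → a ^ n ≋ a′ ^ n
  ^-≋ zero p = ≋-refl
  ^-≋ (suc n) p = *-≋ p (^-≋ n p)

  l≋0 : ∀ k → k * l ≋ 0
  l≋0 k = +-multiples⇒≋ 0 k (+-identityʳ (k * l))

  neg-cancel : ∀ a b → a + (b + r * b) ≋ a
  neg-cancel a b = +-multiples⇒≋ 0 b (solve (a List.∷ b List.∷ r List.∷ List.[]))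

  neg-neg : ∀ a → r * (r * a) ≋ a
  neg-neg a = +-multiples⇒≋ a (r * a) (solve (a List.∷ r List.∷ List.[]))

  t-[t-i]≋i : ∀ t i → t + r * (t + r * i) ≋ i
  t-[t-i]≋i t i = +-multiples⇒≋ i (t + r * i) (solve (t List.∷ i List.∷ r List.∷ List.[]))

  +-cancelʳ-≋ : ∀ {a b} c → a + c ≋ b + c → a ≋ b
  +-cancelʳ-≋ {a} {b} c p = begin
    a                ≈⟨ neg-cancel a c ⟨
    a + (c + r * c)  ≡⟨ +-assoc a c (r * c) ⟨
    a + c + r * c    ≈⟨ +-≋ p ≋-refl ⟩
    b + c + r * c    ≡⟨ +-assoc b c (r * c) ⟩
    b + (c + r * c)  ≈⟨ neg-cancel b c ⟩
    b                ∎

  a+b≋c⇒a≋c-b : ∀ {a b c} → a + b ≋ c → a ≋ c + r * b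
  a+b≋c⇒a≋c-b {a} {b} {c} p = begin
    a                ≈⟨ neg-cancel a b ⟨
    a + (b + r * b)  ≡⟨ +-assoc a b (r * b) ⟨
    a + b + r * b    ≈⟨ +-≋ p ≋-refl ⟩
    c + r * b        ∎

  a≋c-b⇒a+b≋c : ∀ {a b c} → a ≋ c + r * b → a + b ≋ c
  a≋c-b⇒a+b≋c {a} {b} {c} p = begin
    a + b            ≈⟨ +-≋ p ≋-refl ⟩
    c + r * b + b    ≡⟨ solve (b List.∷ c List.∷ r List.∷ List.[]) ⟩
    c + (b + r * b)  ≈⟨ neg-cancel c b ⟩
    c                ∎

  unit-cancel : ∀ a a′ → a * a′ ≋ 1 → ∀ x → a * (a′ * x) ≋ x
  unit-cancel a a′ u x = begin
    a * (a′ * x)  ≡⟨ *-assoc a a′ x ⟨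
    a * a′ * x    ≈⟨ *-≋ u (≋-refl {x}) ⟩
    1 * x         ≡⟨ *-identityˡ x ⟩
    x             ∎

  unit-swap : ∀ a a′ → a * a′ ≋ 1 → a′ * a ≋ 1
  unit-swap a a′ u = ≋-trans (≡⇒≋ (*-comm a′ a)) u

  unit-≋0 : ∀ a a′ → a * a′ ≋ 1 → ∀ {x} → a * x ≋ 0 → x ≋ 0
  unit-≋0 a a′ u {x} p = begin
    x             ≈⟨ unit-cancel a′ a (unit-swap a a′ u) x ⟨
    a′ * (a * x)  ≈⟨ *-≋ (≋-refl {a′}) p ⟩
    a′ * 0        ≡⟨ *-zeroʳ a′ ⟩
    0             ∎

  *-≋0 : ∀ a {x} → x ≋ 0 → a * x ≋ 0
  *-≋0 a p = ≋-trans (*-≋ (≋-refl {a}) p) (≡⇒≋ (*-zeroʳ a))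

  residue : ℕ → Fin l
  residue a = fromℕ< (m%n<n a l)

  residue-≋ : ∀ a → toℕ (residue a) ≋ a
  residue-≋ a = ≋-trans (≡⇒≋ (toℕ-fromℕ< (m%n<n a l))) (%-≋ a)

  toℕ-≋-injective : ∀ {i j : Fin l} → toℕ i ≋ toℕ j → i ≡ j
  toℕ-≋-injective {i} {j} p = toℕ-injective (≋⇒≡ (toℕ<n i) (toℕ<n j) p)

  module _ (τ τ′ : ℕ → ℕ) (τ-≋ : ∀ {a b} → a ≋ b → τ a ≋ τ b)
    (τ′-≋ : ∀ {a b} → a ≋ b → τ′ a ≋ τ′ b)
    (ττ′ : ∀ a → τ (τ′ a) ≋ a) (τ′τ : ∀ a → τ′ (τ a) ≋ a) where

    residuePermutation : Permutation′ l
    residuePermutation = permutation (residue ∘ τ ∘ toℕ) (residue ∘ τ′ ∘ toℕ)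
      (λ i → toℕ-≋-injective (≋-trans (residue-≋ _)
        (≋-trans (τ-≋ (residue-≋ (τ′ (toℕ i)))) (ττ′ (toℕ i)))))
      (λ i → toℕ-≋-injective (≋-trans (residue-≋ _)
        (≋-trans (τ′-≋ (residue-≋ (τ (toℕ i)))) (τ′τ (toℕ i)))))

  module PeriodicSums {c ℓ} (K : CommutativeRing c ℓ) where
    private module K = CommutativeRing K
    open FiniteSums K

    Periodic : (ℕ → K.Carrier) → Set ℓ
    Periodic g = ∀ {a b} → a ≋ b → g a K.≈ g b

    -- Maps on ℕ that respect congruence and are inverse modulo `l` permute the residues;
    -- periodicity of `g` makes it irrelevant that their values leave the range below `l`.
    ∑-reindex : ∀ {g} → Periodic g → (τ τ′ : ℕ → ℕ) →
      (∀ {a b} → a ≋ b → τ a ≋ τ b) → (∀ {a b} → a ≋ b → τ′ a ≋ τ′ b) →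
      (∀ a → τ (τ′ a) ≋ a) → (∀ a → τ′ (τ a) ≋ a) →
      ∑[ i < l ] g (τ (toℕ i)) K.≈ ∑[ i < l ] g (toℕ i)
    ∑-reindex per τ τ′ p p′ q q′ = K.trans
      (∑-cong λ i → per (≋-sym (residue-≋ (τ (toℕ i)))))
      (K.sym (∑-permute (residuePermutation τ τ′ p p′ q q′)))

    ∑-translate : ∀ {g} → Periodic g → ∀ c → ∑[ i < l ] g (toℕ i + c) K.≈ ∑[ i < l ] g (toℕ i)
    ∑-translate per c = ∑-reindex per (_+ c) (_+ r * c)
      (λ p → +-≋ p ≋-refl) (λ p → +-≋ p ≋-refl)
      (λ a → ≋-trans (≡⇒≋ (≡.trans (+-assoc a (r * c) c) (≡.cong (a +_) (+-comm (r * c) c)))) (neg-cancel a c))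
      (λ a → ≋-trans (≡⇒≋ (+-assoc a c (r * c))) (neg-cancel a c))

    ∑-reflect : ∀ {g} → Periodic g → ∀ t → ∑[ i < l ] g (t + r * toℕ i) K.≈ ∑[ i < l ] g (toℕ i)
    ∑-reflect per t = ∑-reindex per (λ i → t + r * i) (λ i → t + r * i)
      (λ p → +-≋ ≋-refl (*-≋ (≋-refl {r}) p)) (λ p → +-≋ ≋-refl (*-≋ (≋-refl {r}) p))
      (t-[t-i]≋i t) (t-[t-i]≋i t)

    ∑-dilate : ∀ {g} → Periodic g → ∀ a a′ → a * a′ ≋ 1 →
      ∑[ i < l ] g (a * toℕ i) K.≈ ∑[ i < l ] g (toℕ i)
    ∑-dilate per a a′ u = ∑-reindex per (a *_) (a′ *_)
      (*-≋ (≋-refl {a})) (*-≋ (≋-refl {a′}))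
      (unit-cancel a a′ u) (unit-cancel a′ a (unit-swap a a′ u))

-- Norm, trace and permanent attached to a ring endomorphism σ.

module Permanent {c ℓ} (B : CommutativeRing c ℓ)
  (σ : CommutativeRing.Carrier B → CommutativeRing.Carrier B)
  (σ-hom : IsRingHomomorphism (CommutativeRing.rawRing B) (CommutativeRing.rawRing B) σ)
  where
  open CommutativeRing B hiding (zero)
  open FiniteSums B
  open SemiringMult semiring using (×-congʳ; ×-comm-*; ×-assocˡ) renaming (_×_ to _·_)
  open CommSemigroup +-commutativeSemigroup using () renaming (x∙yz≈y∙xz to +-x∙yz≈y∙xz)
  open CommSemigroup *-commutativeSemigroup using () renaming (x∙yz≈y∙xz to *-x∙yz≈y∙xz; interchange to *-interchange; x∙yz≈xy∙z to *-x∙yz≈xy∙z)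
  open SetoidReasoning setoid
  open IsRingHomomorphism σ-hom public
    using () renaming (⟦⟧-cong to σ-cong; +-homo to σ-+; *-homo to σ-*; 0#-homo to σ-0; 1#-homo to σ-1)

  σ-∑ : ∀ {n} {g : Fin n → Carrier} → σ (∑ n g) ≈ ∑[ i < n ] σ (g i)
  σ-∑ {zero} = trans (σ-cong (reflexive ∑-zero)) (trans σ-0 (reflexive (≡.sym ∑-zero)))
  σ-∑ {suc n} = trans (σ-cong (reflexive ∑-suc))
    (trans (σ-+ _ _) (trans (+-congˡ σ-∑) (reflexive (≡.sym ∑-suc))))

  σ-· : ∀ n x → σ (n · x) ≈ n · σ x
  σ-· zero x = σ-0
  σ-· (suc n) x = trans (σ-+ _ _) (+-congˡ (σ-· n x))

  σ^ : ℕ → Carrier → Carrier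
  σ^ zero x = x
  σ^ (suc n) x = σ (σ^ n x)

  σ^-cong : ∀ n {x y} → x ≈ y → σ^ n x ≈ σ^ n y
  σ^-cong zero e = e
  σ^-cong (suc n) e = σ-cong (σ^-cong n e)

  σ^-+ : ∀ n x y → σ^ n (x + y) ≈ σ^ n x + σ^ n y
  σ^-+ zero x y = refl
  σ^-+ (suc n) x y = trans (σ-cong (σ^-+ n x y)) (σ-+ _ _)

  σ^-* : ∀ n x y → σ^ n (x * y) ≈ σ^ n x * σ^ n y
  σ^-* zero x y = refl
  σ^-* (suc n) x y = trans (σ-cong (σ^-* n x y)) (σ-* _ _)

  σ^-fixed : ∀ n {x} → σ x ≈ x → σ^ n x ≈ x
  σ^-fixed zero e = refl
  σ^-fixed (suc n) e = trans (σ-cong (σ^-fixed n e)) e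

  norm : ℕ → Carrier → Carrier
  norm zero x = 1#
  norm (suc n) x = x * σ (norm n x)

  norm-cong : ∀ n {x y} → x ≈ y → norm n x ≈ norm n y
  norm-cong zero e = refl
  norm-cong (suc n) e = *-cong e (σ-cong (norm-cong n e))

  norm-* : ∀ n x y → norm n (x * y) ≈ norm n x * norm n y
  norm-* zero x y = sym (*-identityˡ _)
  norm-* (suc n) x y = begin
    (x * y) * σ (norm n (x * y))          ≈⟨ *-congˡ (trans (σ-cong (norm-* n x y)) (σ-* _ _)) ⟩
    (x * y) * (σ (norm n x) * σ (norm n y)) ≈⟨ *-interchange _ _ _ _ ⟩
    (x * σ (norm n x)) * (y * σ (norm n y)) ∎

  norm-last : ∀ n x → norm (suc n) x ≈ norm n x * σ^ n x
  norm-last zero x = trans (*-congˡ σ-1) (*-comm _ _)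
  norm-last (suc n) x = begin
    x * σ (norm (suc n) x)              ≈⟨ *-congˡ (trans (σ-cong (norm-last n x)) (σ-* _ _)) ⟩
    x * (σ (norm n x) * σ (σ^ n x))      ≈⟨ *-assoc _ _ _ ⟨
    norm (suc n) x * σ^ (suc n) x ∎

  -- σ shifts the factors x, σx, ... by one place, and the factor σⁿx that appears at the end is the
  -- x lost at the beginning.
  norm-invariant : ∀ n x → σ^ n x ≈ x → σ (norm n x) ≈ norm n x
  norm-invariant zero x e = σ-1
  norm-invariant (suc n) x e = begin
    σ (norm (suc n) x)             ≈⟨ trans (σ-cong (norm-last n x)) (σ-* _ _) ⟩
    σ (norm n x) * σ^ (suc n) x    ≈⟨ *-congˡ e ⟩
    σ (norm n x) * x               ≈⟨ *-comm _ _ ⟩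
    norm (suc n) x ∎

  module _ {τ : Carrier → Carrier}
    (τ-hom : IsRingHomomorphism rawRing rawRing τ)
    (comm : ∀ x → τ (σ x) ≈ σ (τ x)) where
    private module τ = IsRingHomomorphism τ-hom

    norm-natural : ∀ n x → τ (norm n x) ≈ norm n (τ x)
    norm-natural zero x = τ.1#-homo
    norm-natural (suc n) x =
      trans (τ.*-homo _ _) (*-congˡ (trans (comm _) (σ-cong (norm-natural n x))))

  trace : ℕ → Carrier → Carrier
  trace n x = ∑[ k < n ] σ^ (Fin.toℕ k) x

  trace-last : ∀ n x → trace (suc n) x ≈ x + σ (trace n x)
  trace-last n x = trans (reflexive ∑-suc) (+-congˡ (sym σ-∑))

  private
    trace-init : ∀ n x → trace (suc n) x ≈ trace n x + σ^ n x
    trace-init zero x = trans (reflexive ∑-suc) (trans (+-comm _ _) (+-congʳ (∑-cong λ ())))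
    trace-init (suc n) x = begin
      trace (suc (suc n)) x              ≈⟨ trace-last (suc n) x ⟩
      x + σ (trace (suc n) x)            ≈⟨ +-congˡ (trans (σ-cong (trace-init n x)) (σ-+ _ _)) ⟩
      x + (σ (trace n x) + σ^ (suc n) x)  ≈⟨ +-assoc _ _ _ ⟨
      (x + σ (trace n x)) + σ^ (suc n) x  ≈⟨ +-congʳ (trace-last n x) ⟨
      trace (suc n) x + σ^ (suc n) x ∎

  trace-invariant : ∀ n x → σ^ n x ≈ x → σ (trace n x) ≈ trace n x
  trace-invariant zero x e = trans σ-∑ (∑-cong λ ())
  trace-invariant (suc n) x e = begin
    σ (trace (suc n) x)                ≈⟨ trans (σ-cong (trace-init n x)) (σ-+ _ _) ⟩
    σ (trace n x) + σ^ (suc n) x       ≈⟨ trans (+-congˡ e) (+-comm _ _) ⟩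
    x + σ (trace n x)                  ≈⟨ trace-last n x ⟨
    trace (suc n) x ∎

  trace-*-fixed : ∀ n x {y} → σ y ≈ y → trace n x * y ≈ trace n (x * y)
  trace-*-fixed n x {y} e = trans (∑-* y)
    (∑-cong λ k → trans (*-congˡ (sym (σ^-fixed (Fin.toℕ k) e)))
                            (sym (σ^-* (Fin.toℕ k) x y)))

  -- The permanent of the matrix (σʲ vᵢ), expanded along j = 0.
  perm : ∀ n → (Fin n → Carrier) → Carrier
  perm zero v = 1#
  perm (suc n) v = ∑[ i < suc n ] (v i * σ (perm n (v ∘ punchIn i)))

  perm-cong : ∀ n {v w : Fin n → Carrier} → (∀ i → v i ≈ w i) → perm n v ≈ perm n w
  perm-cong zero e = refl
  perm-cong (suc n) e =
    ∑-cong λ i → *-cong (e i) (σ-cong (perm-cong n (e ∘ punchIn i)))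

  -- Every term contains the entry at `j` once, under some power of σ, through which a fixed scalar
  -- passes unchanged. Stating it for three families that agree off `j` makes it fit the recursive
  -- call, where `j` is seen through `punchIn`.
  perm-linear : ∀ n (j : Fin n) {s} → σ s ≈ s → (v v₁ v₂ : Fin n → Carrier) →
    v j ≈ s * v₁ j + v₂ j →
    (∀ k → k ≢ j → v k ≈ v₁ k) → (∀ k → k ≢ j → v k ≈ v₂ k) →
    perm n v ≈ s * perm n v₁ + perm n v₂
  perm-linear (suc n) j {s} fixed v v₁ v₂ at-j off₁ off₂ = begin
    perm (suc n) v
      ≈⟨ ∑-cong term ⟩
    ∑[ i < suc n ] (s * a₁ i + a₂ i)
      ≈⟨ ∑-+ ⟩
    ∑[ i < suc n ] (s * a₁ i) + perm (suc n) v₂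
      ≈⟨ +-congʳ (*-∑ s) ⟨
    s * perm (suc n) v₁ + perm (suc n) v₂ ∎
    where
    a a₁ a₂ : Fin (suc n) → Carrier
    a i = v i * σ (perm n (v ∘ punchIn i))
    a₁ i = v₁ i * σ (perm n (v₁ ∘ punchIn i))
    a₂ i = v₂ i * σ (perm n (v₂ ∘ punchIn i))
    term : ∀ i → a i ≈ s * a₁ i + a₂ i
    term i with i Fin.≟ j
    ... | yes ≡.refl = begin
      v i * σ (perm n (v ∘ punchIn i))       ≈⟨ *-congʳ at-j ⟩
      (s * v₁ i + v₂ i) * σ (perm n (v ∘ punchIn i)) ≈⟨ distribʳ _ _ _ ⟩
      s * v₁ i * σ (perm n (v ∘ punchIn i)) + v₂ i * σ (perm n (v ∘ punchIn i))
        ≈⟨ +-cong (trans (*-assoc _ _ _) (*-congˡ (*-congˡ (σ-cong (perm-cong n λ k → off₁ _ (punchInᵢ≢i i k))))))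
                  (*-congˡ (σ-cong (perm-cong n λ k → off₂ _ (punchInᵢ≢i i k)))) ⟩
      s * a₁ i + a₂ i ∎
    ... | no i≢j = begin
      v i * σ (perm n (v ∘ punchIn i))
        ≈⟨ *-congˡ (trans (σ-cong ih) (trans (σ-+ _ _) (+-congʳ (trans (σ-* _ _) (*-congʳ fixed))))) ⟩
      v i * (s * σ (perm n (v₁ ∘ punchIn i)) + σ (perm n (v₂ ∘ punchIn i)))
        ≈⟨ distribˡ _ _ _ ⟩
      v i * (s * σ (perm n (v₁ ∘ punchIn i))) + v i * σ (perm n (v₂ ∘ punchIn i))
        ≈⟨ +-cong (trans (*-x∙yz≈y∙xz _ _ _) (*-congˡ (*-congʳ (off₁ i i≢j)))) (*-congʳ (off₂ i i≢j)) ⟩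
      s * a₁ i + a₂ i ∎
      where
      j≡ : punchIn i (punchOut i≢j) ≡ j
      j≡ = punchIn-punchOut i≢j
      off : ∀ {k} → k ≢ punchOut i≢j → punchIn i k ≢ j
      off k≢ e = k≢ (punchIn-injective i _ _ (≡.trans e (≡.sym j≡)))
      ih : perm n (v ∘ punchIn i) ≈ s * perm n (v₁ ∘ punchIn i) + perm n (v₂ ∘ punchIn i)
      ih = perm-linear n (punchOut i≢j) fixed _ _ _
        (≡.subst (λ m → v m ≈ s * v₁ m + v₂ m) (≡.sym j≡) at-j)
        (λ k k≢ → off₁ _ (off k≢)) (λ k k≢ → off₂ _ (off k≢))

  perm-permute : ∀ n (π : Permutation′ n) (v : Fin n → Carrier) →
    perm n (v ∘ (π ⟨$⟩ʳ_)) ≈ perm n v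
  perm-permute zero π v = refl
  perm-permute (suc n) π v = begin
    perm (suc n) (v ∘ (π ⟨$⟩ʳ_))
      ≈⟨ ∑-cong (λ i → *-congˡ (σ-cong (trans
           (perm-cong n λ k → reflexive (≡.cong v (Perm.punchIn-permute π i k)))
           (perm-permute n (Perm.remove i π) (v ∘ punchIn (π ⟨$⟩ʳ i)))))) ⟩
    ∑[ i < suc n ] (v (π ⟨$⟩ʳ i) * σ (perm n (v ∘ punchIn (π ⟨$⟩ʳ i))))
      ≈⟨ ∑-permute π ⟨
    perm (suc n) v ∎

  perm-diagonal : ∀ n x → perm n (λ _ → x) ≈ (n !) · norm n x
  perm-diagonal zero x = sym (+-identityʳ _)
  perm-diagonal (suc n) x = begin
    ∑[ i < suc n ] (x * σ (perm n (λ _ → x)))  ≈⟨ ∑-const (suc n) ⟩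
    suc n · (x * σ (perm n (λ _ → x)))
      ≈⟨ ×-congʳ (suc n) (*-congˡ (trans (σ-cong (perm-diagonal n x)) (σ-· (n !) _))) ⟩
    suc n · (x * ((n !) · σ (norm n x)))
      ≈⟨ ×-congʳ (suc n) (×-comm-* (n !) _ _) ⟩
    suc n · ((n !) · norm (suc n) x)           ≈⟨ ×-assocˡ _ (suc n) (n !) ⟩
    (suc n !) · norm (suc n) x ∎

  private
    ∑∑-swap : ∀ n (H : Carrier → Carrier → (Fin n → Carrier) → Carrier) →
      (∀ a b {w w′} → w ≗ w′ → H a b w ≈ H a b w′) →
      (v : Fin (suc (suc n)) → Carrier) →
      ∑[ i < suc (suc n) ] ∑[ j < suc n ] H (v i) (v (punchIn i j)) (v ∘ punchIn i ∘ punchIn j)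
      ≈ ∑[ i < suc (suc n) ] ∑[ j < suc n ] H (v (punchIn i j)) (v i) (v ∘ punchIn i ∘ punchIn j)
    ∑∑-swap n H ext v = begin
      ∑[ i < suc (suc n) ] ∑[ j < suc n ] H (v i) (v (punchIn i j)) (v ∘ punchIn i ∘ punchIn j)
        ≡⟨ ∑-suc ⟩
      S + ∑[ i < suc n ] ∑[ j < suc n ] H (v (Fin.suc i)) (v (punchIn (Fin.suc i) j)) (v ∘ punchIn (Fin.suc i) ∘ punchIn j)
        ≈⟨ +-congˡ (∑-cong λ i → reflexive ∑-suc) ⟩
      S + ∑[ i < suc n ] (H (v (Fin.suc i)) (v Fin.zero) (v ∘ Fin.suc ∘ punchIn i) + rest₁ i)
        ≈⟨ +-congˡ (∑-+) ⟩
      S + (S′ + ∑ (suc n) rest₁)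
        ≈⟨ +-x∙yz≈y∙xz _ _ _ ⟩
      S′ + (S + ∑ (suc n) rest₁)
        ≈⟨ +-congˡ (+-congˡ (tails n H ext v)) ⟩
      S′ + (S + ∑ (suc n) rest₂)
        ≈⟨ +-congˡ (∑-+) ⟨
      S′ + ∑[ i < suc n ] (H (v Fin.zero) (v (Fin.suc i)) (v ∘ Fin.suc ∘ punchIn i) + rest₂ i)
        ≈⟨ +-congˡ (∑-cong λ i → reflexive ∑-suc) ⟨
      S′ + ∑[ i < suc n ] ∑[ j < suc n ] H (v (punchIn (Fin.suc i) j)) (v (Fin.suc i)) (v ∘ punchIn (Fin.suc i) ∘ punchIn j)
        ≡⟨ ∑-suc ⟨
      ∑[ i < suc (suc n) ] ∑[ j < suc n ] H (v (punchIn i j)) (v i) (v ∘ punchIn i ∘ punchIn j) ∎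
      where
      S S′ : Carrier
      S = ∑[ j < suc n ] H (v Fin.zero) (v (Fin.suc j)) (v ∘ Fin.suc ∘ punchIn j)
      S′ = ∑[ i < suc n ] H (v (Fin.suc i)) (v Fin.zero) (v ∘ Fin.suc ∘ punchIn i)
      rest₁ rest₂ : Fin (suc n) → Carrier
      rest₁ i = ∑[ j < n ] H (v (Fin.suc i)) (v (Fin.suc (punchIn i j)))
                             (v ∘ punchIn (Fin.suc i) ∘ punchIn (Fin.suc j))
      rest₂ i = ∑[ j < n ] H (v (Fin.suc (punchIn i j))) (v (Fin.suc i))
                             (v ∘ punchIn (Fin.suc i) ∘ punchIn (Fin.suc j))
      tails : ∀ n (H : Carrier → Carrier → (Fin n → Carrier) → Carrier) →
        (∀ a b {w w′} → w ≗ w′ → H a b w ≈ H a b w′) →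
        (v : Fin (suc (suc n)) → Carrier) →
        ∑[ i < suc n ] ∑[ j < n ] H (v (Fin.suc i)) (v (Fin.suc (punchIn i j)))
                             (v ∘ punchIn (Fin.suc i) ∘ punchIn (Fin.suc j))
        ≈ ∑[ i < suc n ] ∑[ j < n ] H (v (Fin.suc (punchIn i j))) (v (Fin.suc i))
                             (v ∘ punchIn (Fin.suc i) ∘ punchIn (Fin.suc j))
      tails zero H ext v = ∑-cong λ i → ∑-cong λ ()
      tails (suc n) H ext v = begin
        -- Neither chosen index is 0, so `v 0` can be moved into `H` as a constant, which brings the
        -- sum to the shape of the induction hypothesis.
        _ ≈⟨ ∑-cong (λ i → ∑-cong λ j → ext _ _ (split i j)) ⟩
        _ ≈⟨ ∑∑-swap n (λ a b w → H a b (v Fin.zero ∷ w)) (λ a b e → ext a b (∷-cong e)) (v ∘ Fin.suc) ⟩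
        _ ≈⟨ ∑-cong (λ i → ∑-cong λ j → ext _ _ (≡.sym ∘ split i j)) ⟩
        _ ∎
        where
        ∷-cong : ∀ {w w′ : Fin n → Carrier} → w ≗ w′ → (v Fin.zero ∷ w) ≗ (v Fin.zero ∷ w′)
        ∷-cong e Fin.zero = ≡.refl
        ∷-cong e (Fin.suc k) = e k
        split : ∀ i j → v ∘ punchIn (Fin.suc i) ∘ punchIn (Fin.suc j)
                        ≗ (v Fin.zero ∷ (v ∘ Fin.suc ∘ punchIn i ∘ punchIn j))
        split i j Fin.zero = ≡.refl
        split i j (Fin.suc k) = ≡.refl

  -- Laplace expansion along the last column instead of the first: expand along both, and exchange
  -- the order in which the two rows are chosen.
  perm-last : ∀ n v → perm (suc n) v ≈ ∑[ i < suc n ] (perm n (v ∘ punchIn i) * σ^ n (v i))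
  perm-last zero v = ∑-cong λ i → trans (*-congˡ σ-1) (*-comm _ _)
  perm-last (suc n) v = begin
    ∑[ i < suc (suc n) ] (v i * σ (perm (suc n) (v ∘ punchIn i)))
      ≈⟨ ∑-cong (λ i → begin
           v i * σ (perm (suc n) (v ∘ punchIn i))
             ≈⟨ *-congˡ (trans (σ-cong (perm-last n (v ∘ punchIn i))) (σ-∑)) ⟩
           v i * ∑[ j < suc n ] σ (perm n (v ∘ punchIn i ∘ punchIn j) * σ^ n (v (punchIn i j)))
             ≈⟨ *-∑ _ ⟩
           ∑[ j < suc n ] (v i * σ (perm n (v ∘ punchIn i ∘ punchIn j) * σ^ n (v (punchIn i j))))
             ≈⟨ ∑-cong (λ j → trans (*-congˡ (σ-* _ _)) (*-x∙yz≈xy∙z _ _ _)) ⟩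
           ∑[ j < suc n ] H (v i) (v (punchIn i j)) (v ∘ punchIn i ∘ punchIn j) ∎) ⟩
    ∑[ i < suc (suc n) ] ∑[ j < suc n ] H (v i) (v (punchIn i j)) (v ∘ punchIn i ∘ punchIn j)
      ≈⟨ ∑∑-swap n H (λ a b e → *-congʳ (*-congˡ (σ-cong (perm-cong n (reflexive ∘ e))))) v ⟩
    ∑[ i < suc (suc n) ] ∑[ j < suc n ] H (v (punchIn i j)) (v i) (v ∘ punchIn i ∘ punchIn j)
      ≈⟨ ∑-cong (λ i → ∑-* _) ⟨
    ∑[ i < suc (suc n) ] (perm (suc n) (v ∘ punchIn i) * σ^ (suc n) (v i)) ∎
    where
    H : Carrier → Carrier → (Fin n → Carrier) → Carrier
    H a b w = (a * σ (perm n w)) * σ^ (suc n) b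

  -- σ moves each column of the matrix to the next. Its last column becomes the original first one,
  -- because σⁿ is the identity, so the expansion along the last column turns into the defining one.
  perm-invariant : ∀ n → (∀ x → σ^ n x ≈ x) → ∀ v → σ (perm n v) ≈ perm n v
  perm-invariant zero cyclic v = σ-1
  perm-invariant (suc n) cyclic v = begin
    σ (perm (suc n) v)
      ≈⟨ trans (σ-cong (perm-last n v)) (σ-∑) ⟩
    ∑[ i < suc n ] σ (perm n (v ∘ punchIn i) * σ^ n (v i))
      ≈⟨ ∑-cong (λ i → trans (σ-* _ _) (trans (*-congˡ (cyclic (v i))) (*-comm _ _))) ⟩
    perm (suc n) v ∎

-- The cyclotomic quotient ring and its automorphisms.

-- K[X]/(1 + X + ⋯ + X^{l-1}): l-periodic coefficient functions under cyclic
-- convolution, two of them being equal when they differ by a constant.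
module Cyclotomic {c ℓ} (K : CommutativeRing c ℓ) (r : ℕ) where
  open CommutativeRing K hiding (zero)
  open FiniteSums K
  open Residues r
  open PeriodicSums K
  open RingProperties ring using (-0#≈0#; -‿+-comm; -‿distribʳ-*)
  open CommSemigroup +-commutativeSemigroup using () renaming (interchange to +-interchange)
  open SetoidReasoning setoid

  record Element : Set (c ⊔ ℓ) where
    constructor element
    field
      coeff : ℕ → Carrier
      periodic : Periodic coeff
  open Element public

  infix 4 _≐_ _≈ᴮ_
  -- Equality in the group ring K[X]/(X^l - 1), before constants are divided out. Most ring laws
  -- already hold there and are then passed to the quotient.
  _≐_ : Element → Element → Set ℓ
  p ≐ q = ∀ t → coeff p t ≈ coeff q t

  record _≈ᴮ_ (p q : Element) : Set (c ⊔ ℓ) where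
    constructor differBy
    field
      difference : Carrier
      coeff-≈ : ∀ t → coeff p t ≈ coeff q t + difference
  open _≈ᴮ_ public

  ≐⇒≈ᴮ : ∀ {p q} → p ≐ q → p ≈ᴮ q
  ≐⇒≈ᴮ e = differBy 0# λ t → trans (e t) (sym (+-identityʳ _))

  opaque
    δ : ℕ → ℕ → Carrier
    δ a b with a ≋? b
    ... | yes _ = 1#
    ... | no _ = 0#

    δ-true : ∀ {a b} → a ≋ b → δ a b ≈ 1#
    δ-true {a} {b} e with a ≋? b
    ... | yes _ = refl
    ... | no a≢b = contradiction e a≢b

    δ-false : ∀ {a b} → ¬ a ≋ b → δ a b ≈ 0#
    δ-false {a} {b} a≢b with a ≋? b
    ... | yes e = contradiction e a≢b
    ... | no _ = refl

  δ-cong : ∀ {a b a′ b′} → (a ≋ b → a′ ≋ b′) → (a′ ≋ b′ → a ≋ b) → δ a b ≈ δ a′ b′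
  δ-cong {a} {b} to from with a ≋? b
  ... | yes e = trans (δ-true e) (sym (δ-true (to e)))
  ... | no ¬e = trans (δ-false ¬e) (sym (δ-false (¬e ∘ from)))

  infixl 6 _+ᴮ_
  infixl 7 _*ᴮ_
  opaque
    _+ᴮ_ _*ᴮ_ : Element → Element → Element
    p +ᴮ q = element (λ t → coeff p t + coeff q t) λ e → +-cong (periodic p e) (periodic q e)
    p *ᴮ q = element (λ t → ∑[ i < l ] (coeff p (toℕ i) * coeff q (t ℕ.+ r ℕ.* toℕ i)))
      λ e → ∑-cong λ i → *-congˡ (periodic q (+-≋ e ≋-refl))

    -ᴮ_ : Element → Element
    -ᴮ p = element (λ t → - coeff p t) λ e → -‿cong (periodic p e)

    0ᴮ : Element
    0ᴮ = element (λ _ → 0#) λ _ → refl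

    ζ^ : ℕ → Element
    ζ^ a = element (λ t → δ t a) λ e → δ-cong (≋-trans (≋-sym e)) (≋-trans e)

    ι : Carrier → Element
    ι x = element (λ t → x * δ t 0) λ e → *-congˡ (periodic (ζ^ 0) e)

    -- ψ a is the automorphism ζ ↦ ζ^{1/a}, for a a unit modulo l.
    ψ : ℕ → Element → Element
    ψ a p = element (λ t → coeff p (a ℕ.* t)) λ e → periodic p (*-≋ (≋-refl {a}) e)

  1ᴮ : Element
  1ᴮ = ζ^ 0

  ≈ᴮ-refl : ∀ {p} → p ≈ᴮ p
  ≈ᴮ-refl = ≐⇒≈ᴮ λ t → refl

  ≈ᴮ-sym : ∀ {p q} → p ≈ᴮ q → q ≈ᴮ p
  ≈ᴮ-sym {p} {q} (differBy d e) = differBy (- d) λ t → sym (begin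
    coeff p t + - d          ≈⟨ +-congʳ (e t) ⟩
    coeff q t + d + - d      ≈⟨ +-assoc _ _ _ ⟩
    coeff q t + (d + - d)    ≈⟨ +-congˡ (-‿inverseʳ d) ⟩
    coeff q t + 0#           ≈⟨ +-identityʳ _ ⟩
    coeff q t                ∎)

  ≈ᴮ-trans : ∀ {p q s} → p ≈ᴮ q → q ≈ᴮ s → p ≈ᴮ s
  ≈ᴮ-trans (differBy d e) (differBy d′ e′) = differBy (d′ + d) λ t →
    trans (e t) (trans (+-congʳ (e′ t)) (+-assoc _ _ _))

  opaque
    unfolding _+ᴮ_

    coeff-+ : ∀ p q t → coeff (p +ᴮ q) t ≡ coeff p t + coeff q t
    coeff-+ p q t = ≡.refl

    coeff-* : ∀ p q t → coeff (p *ᴮ q) t ≡ ∑[ i < l ] (coeff p (toℕ i) * coeff q (t ℕ.+ r ℕ.* toℕ i))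
    coeff-* p q t = ≡.refl

    coeff-neg : ∀ p t → coeff (-ᴮ p) t ≡ - coeff p t
    coeff-neg p t = ≡.refl

    coeff-0 : ∀ t → coeff 0ᴮ t ≡ 0#
    coeff-0 t = ≡.refl

    coeff-ζ^ : ∀ a t → coeff (ζ^ a) t ≡ δ t a
    coeff-ζ^ a t = ≡.refl

    coeff-ι : ∀ x t → coeff (ι x) t ≡ x * δ t 0
    coeff-ι x t = ≡.refl

    coeff-ψ : ∀ a p t → coeff (ψ a p) t ≡ coeff p (a ℕ.* t)
    coeff-ψ a p t = ≡.refl

    +ᴮ-cong : ∀ {p p′ q q′} → p ≈ᴮ p′ → q ≈ᴮ q′ → p +ᴮ q ≈ᴮ p′ +ᴮ q′
    +ᴮ-cong (differBy d e) (differBy d′ e′) = differBy (d + d′) λ t →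
      trans (+-cong (e t) (e′ t)) (+-interchange _ _ _ _)

    -ᴮ-cong : ∀ {p p′} → p ≈ᴮ p′ → -ᴮ p ≈ᴮ -ᴮ p′
    -ᴮ-cong (differBy d e) = differBy (- d) λ t → trans (-‿cong (e t)) (sym (-‿+-comm _ _))

    private
      summand-periodic : ∀ p q t → Periodic (λ i → coeff p i * coeff q (t ℕ.+ r ℕ.* i))
      summand-periodic p q t e =
        *-cong (periodic p e) (periodic q (+-≋ (≋-refl {t}) (*-≋ (≋-refl {r}) e)))

    *ᴮ-comm : ∀ p q → p *ᴮ q ≐ q *ᴮ p
    *ᴮ-comm p q t = begin
      coeff (p *ᴮ q) t
        ≈⟨ ∑-reflect (summand-periodic p q t) t ⟨
      ∑[ i < l ] (coeff p (t ℕ.+ r ℕ.* toℕ i) * coeff q (t ℕ.+ r ℕ.* (t ℕ.+ r ℕ.* toℕ i)))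
        ≈⟨ ∑-cong (λ i → trans (*-comm _ _) (*-congʳ (periodic q (t-[t-i]≋i t (toℕ i))))) ⟩
      coeff (q *ᴮ p) t ∎

    *ᴮ-assoc : ∀ p q s → (p *ᴮ q) *ᴮ s ≐ p *ᴮ (q *ᴮ s)
    *ᴮ-assoc p q s t = begin
      ∑[ j < l ] (∑[ i < l ] (coeff p (toℕ i) * coeff q (toℕ j ℕ.+ r ℕ.* toℕ i)) * coeff s (t ℕ.+ r ℕ.* toℕ j))
        ≈⟨ ∑-cong (λ j → trans (∑-* _) (∑-cong λ i → *-assoc _ _ _)) ⟩
      ∑[ j < l ] ∑[ i < l ] (coeff p (toℕ i) * (coeff q (toℕ j ℕ.+ r ℕ.* toℕ i) * coeff s (t ℕ.+ r ℕ.* toℕ j)))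
        ≈⟨ trans ∑-comm (∑-cong λ i → sym (*-∑ _)) ⟩
      ∑[ i < l ] (coeff p (toℕ i) * ∑[ j < l ] (coeff q (toℕ j ℕ.+ r ℕ.* toℕ i) * coeff s (t ℕ.+ r ℕ.* toℕ j)))
        ≈⟨ ∑-cong (λ i → *-congˡ (inner (toℕ i))) ⟩
      coeff (p *ᴮ (q *ᴮ s)) t ∎
      where
      inner : ∀ i → ∑[ j < l ] (coeff q (toℕ j ℕ.+ r ℕ.* i) * coeff s (t ℕ.+ r ℕ.* toℕ j))
                    ≈ coeff (q *ᴮ s) (t ℕ.+ r ℕ.* i)
      inner i = begin
        ∑[ j < l ] (coeff q (toℕ j ℕ.+ r ℕ.* i) * coeff s (t ℕ.+ r ℕ.* toℕ j))
          ≈⟨ ∑-translate {λ j → coeff q (j ℕ.+ r ℕ.* i) * coeff s (t ℕ.+ r ℕ.* j)}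
               (λ e → *-cong (periodic q (+-≋ e ≋-refl))
                             (periodic s (+-≋ (≋-refl {t}) (*-≋ (≋-refl {r}) e)))) i ⟨
        ∑[ j < l ] (coeff q (toℕ j ℕ.+ i ℕ.+ r ℕ.* i) * coeff s (t ℕ.+ r ℕ.* (toℕ j ℕ.+ i)))
          ≈⟨ ∑-cong (λ j → *-cong
               (periodic q (≋-trans (≡⇒≋ (ℕ.+-assoc (toℕ j) i (r ℕ.* i))) (neg-cancel (toℕ j) i)))
               (reflexive (≡.cong (coeff s) (regroup t r (toℕ j) i)))) ⟩
        coeff (q *ᴮ s) (t ℕ.+ r ℕ.* i) ∎
        where
        regroup : ∀ t r j i → t ℕ.+ r ℕ.* (j ℕ.+ i) ≡ t ℕ.+ r ℕ.* i ℕ.+ r ℕ.* j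
        regroup = solve-∀

    ζ^-* : ∀ a p t → coeff (ζ^ a *ᴮ p) t ≈ coeff p (t ℕ.+ r ℕ.* a)
    ζ^-* a p t = begin
      coeff (ζ^ a *ᴮ p) t
        ≈⟨ ∑-single (residue a) (λ i i≢a → trans
             (*-congʳ (δ-false λ e → i≢a (toℕ-≋-injective (≋-trans e (≋-sym (residue-≋ a))))))
             (zeroˡ _)) ⟩
      δ (toℕ (residue a)) a * coeff p (t ℕ.+ r ℕ.* toℕ (residue a))
        ≈⟨ *-cong (δ-true (residue-≋ a)) (periodic p (+-≋ (≋-refl {t}) (*-≋ (≋-refl {r}) (residue-≋ a)))) ⟩
      1# * coeff p (t ℕ.+ r ℕ.* a)
        ≈⟨ *-identityˡ _ ⟩
      coeff p (t ℕ.+ r ℕ.* a) ∎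

    *ᴮ-identityˡ : ∀ p → 1ᴮ *ᴮ p ≐ p
    *ᴮ-identityˡ p t = trans (ζ^-* 0 p t)
      (reflexive (≡.cong (coeff p) (≡.trans (≡.cong (t ℕ.+_) (ℕ.*-zeroʳ r)) (ℕ.+-identityʳ t))))

    *ᴮ-distribʳ : ∀ s p q → (p +ᴮ q) *ᴮ s ≐ p *ᴮ s +ᴮ q *ᴮ s
    *ᴮ-distribʳ s p q t = trans (∑-cong λ i → distribʳ _ _ _) ∑-+

    -- Constant functions form an ideal: since t - i runs through all residues with i, the constant
    -- `d` convolved with `q` is `d` times the sum of the coefficients of `q`.
    *ᴮ-congʳ : ∀ {p p′} q → p ≈ᴮ p′ → p *ᴮ q ≈ᴮ p′ *ᴮ q
    *ᴮ-congʳ {p} {p′} q (differBy d e) = differBy (d * ∑[ i < l ] coeff q (toℕ i)) λ t → begin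
      coeff (p *ᴮ q) t
        ≈⟨ ∑-cong (λ i → trans (*-congʳ (e (toℕ i))) (distribʳ _ _ _)) ⟩
      ∑[ i < l ] (coeff p′ (toℕ i) * coeff q (t ℕ.+ r ℕ.* toℕ i) + d * coeff q (t ℕ.+ r ℕ.* toℕ i))
        ≈⟨ ∑-+ ⟩
      coeff (p′ *ᴮ q) t + ∑[ i < l ] (d * coeff q (t ℕ.+ r ℕ.* toℕ i))
        ≈⟨ +-congˡ (*-∑ d) ⟨
      coeff (p′ *ᴮ q) t + d * ∑[ i < l ] coeff q (t ℕ.+ r ℕ.* toℕ i)
        ≈⟨ +-congˡ (*-congˡ (∑-reflect (periodic q) t)) ⟩
      coeff (p′ *ᴮ q) t + d * ∑[ i < l ] coeff q (toℕ i) ∎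

    *ᴮ-cong : ∀ {p p′ q q′} → p ≈ᴮ p′ → q ≈ᴮ q′ → p *ᴮ q ≈ᴮ p′ *ᴮ q′
    *ᴮ-cong {p} {p′} {q} {q′} e e′ = ≈ᴮ-trans (*ᴮ-congʳ q e)
      (≈ᴮ-trans (≐⇒≈ᴮ (*ᴮ-comm p′ q))
      (≈ᴮ-trans (*ᴮ-congʳ p′ e′) (≐⇒≈ᴮ (*ᴮ-comm q′ p′))))

    cyclotomic-isCommutativeRing : IsCommutativeRing _≈ᴮ_ _+ᴮ_ _*ᴮ_ -ᴮ_ 0ᴮ 1ᴮ
    cyclotomic-isCommutativeRing = record
        { isRing = record
          { +-isAbelianGroup = record
            { isGroup = record
              { isMonoid = record
                { isSemigroup = record
                  { isMagma = record
                    { isEquivalence = record { refl = ≈ᴮ-refl ; sym = ≈ᴮ-sym ; trans = ≈ᴮ-trans }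
                    ; ∙-cong = +ᴮ-cong }
                  ; assoc = λ p q s → ≐⇒≈ᴮ λ t → +-assoc _ _ _ }
                ; identity = (λ p → ≐⇒≈ᴮ λ t → +-identityˡ _) , (λ p → ≐⇒≈ᴮ λ t → +-identityʳ _) }
              ; inverse = (λ p → ≐⇒≈ᴮ λ t → -‿inverseˡ _) , (λ p → ≐⇒≈ᴮ λ t → -‿inverseʳ _)
              ; ⁻¹-cong = -ᴮ-cong }
            ; comm = λ p q → ≐⇒≈ᴮ λ t → +-comm _ _ }
          ; *-cong = *ᴮ-cong
          ; *-assoc = λ p q s → ≐⇒≈ᴮ (*ᴮ-assoc p q s)
          ; *-identity = (λ p → ≐⇒≈ᴮ (*ᴮ-identityˡ p))
              , (λ p → ≐⇒≈ᴮ λ t → trans (*ᴮ-comm p 1ᴮ t) (*ᴮ-identityˡ p t))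
          ; distrib = (λ s p q → ≐⇒≈ᴮ λ t → trans (*ᴮ-comm s (p +ᴮ q) t) (trans (*ᴮ-distribʳ s p q t)
                (+-cong (*ᴮ-comm p s t) (*ᴮ-comm q s t))))
              , (λ s p q → ≐⇒≈ᴮ (*ᴮ-distribʳ s p q)) }
        ; *-comm = λ p q → ≐⇒≈ᴮ (*ᴮ-comm p q) }

  cyclotomicRing : CommutativeRing (c ⊔ ℓ) (c ⊔ ℓ)
  cyclotomicRing = record { isCommutativeRing = cyclotomic-isCommutativeRing }

  module B = CommutativeRing cyclotomicRing
  module Sumᴮ = FiniteSums cyclotomicRing

  opaque
    unfolding _+ᴮ_

    coeff-∑ : ∀ n (g : Fin n → Element) t → coeff (Sumᴮ.∑ n g) t ≈ ∑[ i < n ] coeff (g i) t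
    coeff-∑ zero g t = trans (reflexive (≡.cong (λ p → coeff p t) Sumᴮ.∑-zero)) (sym (reflexive ∑-zero))
    coeff-∑ (suc n) g t = trans (reflexive (≡.cong (λ p → coeff p t) Sumᴮ.∑-suc))
      (trans (+-congˡ (coeff-∑ n (g ∘ Fin.suc) t)) (sym (reflexive ∑-suc)))

    ζ^-≋ : ∀ {a b} → a ≋ b → ζ^ a ≈ᴮ ζ^ b
    ζ^-≋ e = ≐⇒≈ᴮ λ t → δ-cong (λ p → ≋-trans p e) (λ p → ≋-trans p (≋-sym e))

    ζ^-+ : ∀ a b → ζ^ (a ℕ.+ b) ≈ᴮ ζ^ a *ᴮ ζ^ b
    ζ^-+ a b = ≐⇒≈ᴮ λ t → sym (trans (ζ^-* a (ζ^ b) t)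
      (δ-cong (λ e → ≋-trans (≋-sym (a≋c-b⇒a+b≋c {b} {a} {t} (≋-sym e))) (≡⇒≋ (ℕ.+-comm b a)))
               (λ e → ≋-sym (a+b≋c⇒a≋c-b {b} {a} {t} (≋-trans (≡⇒≋ (ℕ.+-comm b a)) (≋-sym e))))))

    ι-*ᴮ : ∀ x p t → coeff (ι x *ᴮ p) t ≈ x * coeff p t
    ι-*ᴮ x p t = begin
      coeff (ι x *ᴮ p) t        ≈⟨ ∑-cong (λ i → *-assoc _ _ _) ⟩
      ∑[ i < l ] (x * (δ (toℕ i) 0 * coeff p (t ℕ.+ r ℕ.* toℕ i))) ≈⟨ *-∑ x ⟨
      x * coeff (1ᴮ *ᴮ p) t     ≈⟨ *-congˡ (*ᴮ-identityˡ p t) ⟩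
      x * coeff p t             ∎

    ι-cong : ∀ {x y} → x ≈ y → ι x ≈ᴮ ι y
    ι-cong e = ≐⇒≈ᴮ λ t → *-congʳ e

    ι-+ : ∀ x y → ι (x + y) ≈ᴮ ι x +ᴮ ι y
    ι-+ x y = ≐⇒≈ᴮ λ t → distribʳ _ _ _

    ι-* : ∀ x y → ι (x * y) ≈ᴮ ι x *ᴮ ι y
    ι-* x y = ≐⇒≈ᴮ λ t → trans (*-assoc _ _ _) (sym (ι-*ᴮ x (ι y) t))

    ι-0 : ι 0# ≈ᴮ 0ᴮ
    ι-0 = ≐⇒≈ᴮ λ t → zeroˡ _

    ι-1 : ι 1# ≈ᴮ 1ᴮ
    ι-1 = ≐⇒≈ᴮ λ t → *-identityˡ _

    ψ-cong : ∀ a {p q} → p ≈ᴮ q → ψ a p ≈ᴮ ψ a q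
    ψ-cong a (differBy d e) = differBy d λ t → e (a ℕ.* t)

    ψ-0 : ∀ a → ψ a 0ᴮ ≈ᴮ 0ᴮ
    ψ-0 a = ≈ᴮ-refl

    ψ-≋ : ∀ {a b} → a ≋ b → ∀ p → ψ a p ≈ᴮ ψ b p
    ψ-≋ e p = ≐⇒≈ᴮ λ t → periodic p (*-≋ e (≋-refl {t}))

    ψ-1 : ∀ p → ψ 1 p ≈ᴮ p
    ψ-1 p = ≐⇒≈ᴮ λ t → reflexive (≡.cong (coeff p) (ℕ.*-identityˡ t))

    ψ-∘ : ∀ a b p → ψ a (ψ b p) ≈ᴮ ψ (a ℕ.* b) p
    ψ-∘ a b p = ≐⇒≈ᴮ λ t → reflexive (≡.cong (coeff p) (regroup a b t))
      where
      regroup : ∀ a b t → b ℕ.* (a ℕ.* t) ≡ a ℕ.* b ℕ.* t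
      regroup = solve-∀

  ι-cancel : ∀ {x y} → x * y ≈ 1# → ∀ {p} → ι x *ᴮ p ≈ᴮ 0ᴮ → p ≈ᴮ 0ᴮ
  ι-cancel {x} {y} xy≈1 {p} e = B.trans (B.sym (B.*-identityˡ p))
    (B.trans (B.*-congʳ (B.trans (B.sym ι-1) (B.trans (ι-cong (trans (sym xy≈1) (*-comm x y))) (ι-* y x))))
    (B.trans (B.*-assoc _ _ _) (B.trans (B.*-congˡ {ι y} e) (B.zeroʳ (ι y)))))

  ψ-comm : ∀ a b p → ψ a (ψ b p) ≈ᴮ ψ b (ψ a p)
  ψ-comm a b p = B.trans (ψ-∘ a b p)
    (B.trans (ψ-≋ (≡⇒≋ (ℕ.*-comm a b)) p) (B.sym (ψ-∘ b a p)))

  module _ (a a′ : ℕ) (unit : a ℕ.* a′ ≋ 1) where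

    opaque
      unfolding _+ᴮ_

      ψ-ι : ∀ x → ψ a (ι x) ≈ᴮ ι x
      ψ-ι x = ≐⇒≈ᴮ λ t → *-congˡ (δ-cong (unit-≋0 a a′ unit) (*-≋0 a))

      ψ-ζ^ : ∀ i → ψ a (ζ^ i) ≈ᴮ ζ^ (a′ ℕ.* i)
      ψ-ζ^ i = ≐⇒≈ᴮ λ t → δ-cong
        (λ e → ≋-trans (≋-sym (unit-cancel a′ a (unit-swap a a′ unit) t)) (*-≋ (≋-refl {a′}) e))
        (λ e → ≋-trans (*-≋ (≋-refl {a}) e) (unit-cancel a a′ unit i))

      ψ-* : ∀ p q → ψ a (p *ᴮ q) ≈ᴮ ψ a p *ᴮ ψ a q
      ψ-* p q = ≐⇒≈ᴮ λ t → begin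
        coeff (p *ᴮ q) (a ℕ.* t)
          ≈⟨ ∑-dilate (summand-periodic p q (a ℕ.* t)) a a′ unit ⟨
        ∑[ i < l ] (coeff p (a ℕ.* toℕ i) * coeff q (a ℕ.* t ℕ.+ r ℕ.* (a ℕ.* toℕ i)))
          ≈⟨ ∑-cong (λ i → *-congˡ (reflexive (≡.cong (coeff q) (regroup a t r (toℕ i))))) ⟩
        coeff (ψ a p *ᴮ ψ a q) t ∎
        where
        regroup : ∀ a t r i → a ℕ.* t ℕ.+ r ℕ.* (a ℕ.* i) ≡ a ℕ.* (t ℕ.+ r ℕ.* i)
        regroup = solve-∀

      ψ-hom : IsRingHomomorphism B.rawRing B.rawRing (ψ a)
      ψ-hom = record
        { isSemiringHomomorphism = record
          { isNearSemiringHomomorphism = record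
            { +-isMonoidHomomorphism = record
              { isMagmaHomomorphism = record
                { isRelHomomorphism = record { cong = ψ-cong a }
                ; homo = λ p q → ≈ᴮ-refl }
              ; ε-homo = ≈ᴮ-refl }
            ; *-homo = ψ-* }
          ; 1#-homo = B.trans (ψ-ζ^ 0) (ζ^-≋ (≡⇒≋ (ℕ.*-zeroʳ a′))) }
        ; -‿homo = λ p → ≈ᴮ-refl }

      -- The multiples of a unit meet each residue exactly once, so all coefficients of the sum are
      -- 1, and a constant function is zero in the quotient.
      geometric-sum : Sumᴮ.∑ l (λ m → ζ^ (a ℕ.* toℕ m)) ≈ᴮ 0ᴮ
      geometric-sum = differBy 1# λ t → begin
        coeff (Sumᴮ.∑ l (λ m → ζ^ (a ℕ.* toℕ m))) t  ≈⟨ coeff-∑ l _ t ⟩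
        ∑[ m < l ] δ t (a ℕ.* toℕ m)
          ≈⟨ ∑-single (residue (a′ ℕ.* t)) (λ m m≢ → δ-false λ e → m≢ (toℕ-≋-injective
               (≋-trans (≋-sym (solved e)) (≋-sym (residue-≋ (a′ ℕ.* t)))))) ⟩
        δ t (a ℕ.* toℕ (residue (a′ ℕ.* t)))
          ≈⟨ δ-true (≋-sym (≋-trans (*-≋ (≋-refl {a}) (residue-≋ (a′ ℕ.* t))) (unit-cancel a a′ unit t))) ⟩
        1#       ≈⟨ +-identityˡ 1# ⟨
        0# + 1#  ∎
        where
        solved : ∀ {t m} → t ≋ a ℕ.* m → a′ ℕ.* t ≋ m
        solved {t} {m} e = ≋-trans (*-≋ (≋-refl {a′}) e) (unit-cancel a′ a (unit-swap a a′ unit) m)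

    ψ-injective₀ : ∀ {p} → ψ a p ≈ᴮ 0ᴮ → p ≈ᴮ 0ᴮ
    ψ-injective₀ {p} e = B.trans (B.sym (B.trans (ψ-∘ a′ a p)
      (B.trans (ψ-≋ (unit-swap a a′ unit) p) (ψ-1 p)))) (B.trans (ψ-cong a′ e) (ψ-0 a′))

  -- The λ of the overview. The unknown constant in the coefficients cancels in the difference.
  functional : ℕ → Element → Carrier
  functional γ p = coeff p 0 - coeff p γ

  functional-cong : ∀ γ {p q} → p ≈ᴮ q → functional γ p ≈ functional γ q
  functional-cong γ {p} {q} (differBy d e) = begin
    coeff p 0 - coeff p γ                      ≈⟨ +-cong (e 0) (-‿cong (e γ)) ⟩
    (coeff q 0 + d) - (coeff q γ + d)          ≈⟨ +-congˡ (-‿+-comm _ _) ⟨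
    (coeff q 0 + d) + (- coeff q γ + - d)      ≈⟨ +-interchange _ _ _ _ ⟩
    (coeff q 0 - coeff q γ) + (d - d)          ≈⟨ +-congˡ (-‿inverseʳ d) ⟩
    (coeff q 0 - coeff q γ) + 0#               ≈⟨ +-identityʳ _ ⟩
    coeff q 0 - coeff q γ                      ∎

  functional-ι* : ∀ γ x p → functional γ (ι x *ᴮ p) ≈ x * functional γ p
  functional-ι* γ x p = trans
    (+-cong (ι-*ᴮ x p 0) (trans (-‿cong (ι-*ᴮ x p γ)) (-‿distribʳ-* x _)))
    (sym (distribˡ x _ _))

  opaque
    unfolding _+ᴮ_

    functional-+ : ∀ γ p q → functional γ (p +ᴮ q) ≈ functional γ p + functional γ q
    functional-+ γ p q = trans (+-congˡ (sym (-‿+-comm _ _))) (+-interchange _ _ _ _)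

    functional-ι : ∀ {γ} → ¬ γ ≋ 0 → ∀ x → functional γ (ι x) ≈ x
    functional-ι {γ} γ≢0 x = begin
      x * δ 0 0 - x * δ γ 0
        ≈⟨ +-cong (*-congˡ (δ-true ≋-refl)) (-‿cong (*-congˡ (δ-false γ≢0))) ⟩
      x * 1# - x * 0#  ≈⟨ +-cong (*-identityʳ x) (trans (-‿cong (zeroʳ x)) -0#≈0#) ⟩
      x + 0#           ≈⟨ +-identityʳ x ⟩
      x                ∎

-- Irreducibility of the cyclotomic polynomial excludes zero divisors.

module Integrality {c ℓ} (K : CommutativeRing c ℓ) (r : ℕ) where
  open CommutativeRing K hiding (zero)
  open FiniteSums K
  open Residues r
  open PeriodicSums K
  open Cyclotomic K r

  private
    module Poly where
      open SetoidReasoning setoid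

      monicCoeff-toℕ : ∀ n (p : ℕ → Carrier) {i} → i ℕ.< n → monicCoeff K n (p ∘ toℕ) i ≡ p i
      monicCoeff-toℕ (suc n) p {zero} i<n = ≡.refl
      monicCoeff-toℕ (suc n) p {suc i} (s≤s i<n) = monicCoeff-toℕ n (p ∘ suc) i<n

      monicCoeff-top : ∀ n g → monicCoeff K n g n ≡ 1#
      monicCoeff-top zero g = ≡.refl
      monicCoeff-top (suc n) g = monicCoeff-top n _

      monicCoeff-above : ∀ n g {i} → n ℕ.< i → monicCoeff K n g i ≡ 0#
      monicCoeff-above zero g {suc i} n<i = ≡.refl
      monicCoeff-above (suc n) g {suc i} (s≤s n<i) = monicCoeff-above n _ n<i

      -- The polynomial 1 + X + ⋯ + Xⁿ. Through `monicCoeff`, dropping its constant term and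
      -- dividing by X lowers `n` by one definitionally, as the recursion in `divide` requires.
      ones : ℕ → ℕ → Carrier
      ones n = monicCoeff K n (λ _ → 1#)

      ones-≤ : ∀ {n k} → k ℕ.≤ n → ones n k ≡ 1#
      ones-≤ {zero} {zero} z≤n = ≡.refl
      ones-≤ {suc n} {zero} z≤n = ≡.refl
      ones-≤ {suc n} {suc k} (s≤s k≤n) = ones-≤ {n} k≤n

      sumUpTo-cong : ∀ k {g g′} → (∀ i → i ℕ.≤ k → g i ≈ g′ i) → sumUpTo K k g ≈ sumUpTo K k g′
      sumUpTo-cong zero e = e 0 z≤n
      sumUpTo-cong (suc k) e =
        +-cong (sumUpTo-cong k λ i i≤k → e i (ℕ.m≤n⇒m≤1+n i≤k)) (e (suc k) ℕ.≤-refl)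

      sumUpTo-0 : ∀ k {g} → (∀ i → i ℕ.≤ k → g i ≈ 0#) → sumUpTo K k g ≈ 0#
      sumUpTo-0 zero e = e 0 z≤n
      sumUpTo-0 (suc k) e = trans
        (+-cong (sumUpTo-0 k λ i i≤k → e i (ℕ.m≤n⇒m≤1+n i≤k)) (e (suc k) ℕ.≤-refl)) (+-identityʳ _)

      convolution : (ℕ → Carrier) → (ℕ → Carrier) → ℕ → Carrier
      convolution g h k = sumUpTo K k (λ i → g i * h (k ∸ i))

      convolution-one : ∀ g h k → convolution g (monicCoeff K 0 h) k ≈ g k
      convolution-one g h zero = *-identityʳ _
      convolution-one g h (suc k) = begin
        sumUpTo K k (λ i → g i * monicCoeff K 0 h (suc k ∸ i)) + g (suc k) * monicCoeff K 0 h (k ∸ k)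
          ≈⟨ +-cong
               (sumUpTo-0 k λ i i≤k → trans (*-congˡ (reflexive (≡.cong (monicCoeff K 0 h) (ℕ.+-∸-assoc 1 i≤k)))) (zeroʳ _))
               (*-congˡ (reflexive (≡.cong (monicCoeff K 0 h) (ℕ.n∸n≡0 k)))) ⟩
        0# + g (suc k) * 1#  ≈⟨ trans (+-identityˡ _) (*-identityʳ _) ⟩
        g (suc k)            ∎

      convolution-suc : ∀ g h k → convolution g h (suc k) ≈ convolution g (h ∘ suc) k + g (suc k) * h 0
      convolution-suc g h k = +-cong
        (sumUpTo-cong k λ i i≤k → *-congˡ (reflexive (≡.cong h (ℕ.+-∸-assoc 1 i≤k))))
        (*-congˡ (reflexive (≡.cong h (ℕ.n∸n≡0 k))))
  open Poly

  eval : ℕ → (ℕ → Carrier) → Element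
  eval n g = Sumᴮ.∑ n (λ i → ι (g (toℕ i)) B.* ζ^ (toℕ i))

  private
    module Eval where
      open SetoidReasoning B.setoid

      eval-cong : ∀ n {g h} → (∀ i → i ℕ.< n → g i ≈ h i) → eval n g B.≈ eval n h
      eval-cong n e = Sumᴮ.∑-cong λ i → B.*-congʳ (ι-cong (e (toℕ i) (toℕ<n i)))

      eval-+ : ∀ n g h → eval n (λ i → g i + h i) B.≈ eval n g B.+ eval n h
      eval-+ n g h = B.trans (Sumᴮ.∑-cong λ i → B.trans (B.*-congʳ (ι-+ _ _)) (B.distribʳ _ _ _)) Sumᴮ.∑-+

      eval-scale : ∀ n x g → eval n (λ i → x * g i) B.≈ ι x B.* eval n g
      eval-scale n x g = B.trans
        (Sumᴮ.∑-cong λ i → B.trans (B.*-congʳ (ι-* _ _)) (B.*-assoc _ _ _)) (B.sym (Sumᴮ.*-∑ (ι x)))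

      eval-head : ∀ n g → eval (suc n) g B.≈ ι (g 0) B.+ ζ^ 1 B.* eval n (g ∘ suc)
      eval-head n g = begin
        eval (suc n) g
          ≡⟨ Sumᴮ.∑-suc ⟩
        ι (g 0) B.* B.1# B.+ Sumᴮ.∑ n (λ i → ι (g (suc (toℕ i))) B.* ζ^ (suc (toℕ i)))
          ≈⟨ B.+-cong (B.*-identityʳ _) (B.trans
               (Sumᴮ.∑-cong λ i → B.trans (B.*-congˡ (ζ^-+ 1 (toℕ i))) (x∙yz≈y∙xz _ _ _))
               (B.sym (Sumᴮ.*-∑ (ζ^ 1)))) ⟩
        ι (g 0) B.+ ζ^ 1 B.* eval n (g ∘ suc) ∎
        where open CommSemigroup B.*-commutativeSemigroup

      eval-last : ∀ n g → eval (suc n) g B.≈ eval n g B.+ ι (g n) B.* ζ^ n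
      eval-last n g = B.trans Sumᴮ.∑-last (B.+-cong
        (Sumᴮ.∑-cong λ i → B.reflexive (≡.cong term (toℕ-inject₁ i)))
        (B.reflexive (≡.cong term (toℕ-fromℕ n))))
        where
        term : ℕ → Element
        term i = ι (g i) B.* ζ^ i

      eval-last-0 : ∀ n g → g n ≈ 0# → eval (suc n) g B.≈ eval n g
      eval-last-0 n g e = B.trans (eval-last n g) (B.trans
        (B.+-congˡ (B.trans (B.*-congʳ (B.trans (ι-cong e) ι-0)) (B.zeroˡ _))) (B.+-identityʳ _))

      coeff-eval : ∀ {g} → Periodic g → ∀ t → coeff (eval l g) t ≈ g t
      coeff-eval {g} per t = trans (coeff-∑ l _ t) (trans
        (∑-cong λ i → trans (ι-*ᴮ (g (toℕ i)) (ζ^ (toℕ i)) t) (*-congˡ (reflexive (coeff-ζ^ (toℕ i) t))))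
        (trans (∑-single (residue t) λ i i≢ → trans (*-congˡ (δ-false λ e →
                 i≢ (toℕ-≋-injective (≋-trans (≋-sym e) (≋-sym (residue-≋ t)))))) (zeroʳ _))
        (trans (*-cong (per (residue-≋ t)) (δ-true (≋-sym (residue-≋ t)))) (*-identityʳ _))))

      eval-one : ∀ h → eval 1 (monicCoeff K 0 h) B.≈ B.1#
      eval-one h = B.trans (eval-head 0 (monicCoeff K 0 h)) (B.trans
        (B.+-cong ι-1 (B.trans (B.*-congˡ (B.reflexive Sumᴮ.∑-zero)) (B.zeroʳ _))) (B.+-identityʳ _))

      eval-ones : eval (suc r) (ones r) B.≈ B.0#
      eval-ones = B.trans (eval-cong (suc r) λ i i≤r → reflexive (ones-≤ (ℕ.≤-pred i≤r)))
        (differBy 1# λ t → trans (coeff-eval (λ _ → refl) t)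
          (sym (trans (+-congʳ (reflexive (coeff-0 t))) (+-identityˡ 1#))))

      -- Division of 1 + X + ⋯ + X^{b+a} by a monic polynomial of degree a, by
      -- Horner's scheme; the result is recorded both for coefficients and at ζ.
      record Division (a : ℕ) (g : Fin a → Carrier) (b : ℕ) : Set (c ⊔ ℓ) where
        field
          quotient : Fin b → Carrier
          remainder : ℕ → Carrier
          remainder-above : ∀ k → a ℕ.≤ k → remainder k ≈ 0#
          coefficients : ∀ k →
            convolution (monicCoeff K a g) (monicCoeff K b quotient) k + remainder k ≈ ones (b ℕ.+ a) k
          values : eval (suc a) (monicCoeff K a g) B.* eval (suc b) (monicCoeff K b quotient)
            B.+ eval a remainder B.≈ eval (suc (b ℕ.+ a)) (ones (b ℕ.+ a))

      x+[y-x]≈y : ∀ x y → x + (y - x) ≈ y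
      x+[y-x]≈y x y = trans (+-congˡ (+-comm y (- x)))
        (trans (sym (+-assoc _ _ _)) (trans (+-congʳ (-‿inverseʳ x)) (+-identityˡ y)))

      -- If the shorter sum of powers is g q + ρ, the next one is 1 + X (g q + ρ) = g (X q + s) + (1
      -- + X ρ - s g). The base case divides a monic polynomial of the same degree, with quotient 1.
      divide : ∀ a′ (g : Fin (suc a′) → Carrier) b → Division (suc a′) g b
      divide a′ g zero = record
        { quotient = λ ()
        ; remainder = ρ
        ; remainder-above = above
        ; coefficients = λ k → trans (+-congʳ (convolution-one ĝ _ k)) (x+[y-x]≈y (ĝ k) (ones a k))
        ; values = begin
            eval (suc a) ĝ B.* eval 1 (monicCoeff K 0 (λ ())) B.+ eval a ρ
              ≈⟨ B.+-cong (B.trans (B.*-congˡ (eval-one _)) (B.*-identityʳ _))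
                          (B.sym (eval-last-0 a ρ (above a ℕ.≤-refl))) ⟩
            eval (suc a) ĝ B.+ eval (suc a) ρ
              ≈⟨ eval-+ (suc a) ĝ ρ ⟨
            eval (suc a) (λ k → ĝ k + ρ k)
              ≈⟨ eval-cong (suc a) (λ k _ → x+[y-x]≈y (ĝ k) (ones a k)) ⟩
            eval (suc a) (ones a) ∎ }
        where
        a : ℕ
        a = suc a′
        ĝ ρ : ℕ → Carrier
        ĝ = monicCoeff K a g
        ρ k = ones a k - ĝ k
        above : ∀ k → a ℕ.≤ k → ρ k ≈ 0#
        above k a≤k with ℕ.m≤n⇒m<n∨m≡n a≤k
        ... | inj₁ a<k = trans (+-cong (reflexive (monicCoeff-above a (λ _ → 1#) a<k))
                (-‿cong (reflexive (monicCoeff-above a g a<k)))) (-‿inverseʳ 0#)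
        ... | inj₂ ≡.refl = trans (+-cong (reflexive (monicCoeff-top a (λ _ → 1#)))
                (-‿cong (reflexive (monicCoeff-top a g)))) (-‿inverseʳ 1#)
      divide a′ g (suc b) = record
        { quotient = s ∷ D.quotient
        ; remainder = ρ
        ; remainder-above = above
        ; coefficients = coeffs
        ; values = begin
            G B.* eval (suc (suc b)) (monicCoeff K (suc b) (s ∷ D.quotient)) B.+ eval a ρ
              ≈⟨ B.+-cong (B.*-cong (eval-head a ĝ) (eval-head (suc b) (monicCoeff K (suc b) (s ∷ D.quotient))))
                   (B.trans (B.sym (eval-last-0 a ρ (above a ℕ.≤-refl))) (eval-head a ρ)) ⟩
            (ι (ĝ 0) B.+ z B.* G₁) B.* (ι s B.+ z B.* H) B.+ (ι (ρ 0) B.+ z B.* R₁)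
              ≈⟨ solve 7 (λ g₀ z G₁ s H ρ₀ R₁ →
                   ((g₀ :+ z :* G₁) :* (s :+ z :* H) :+ (ρ₀ :+ z :* R₁)) :=
                   ((g₀ :* s :+ ρ₀) :+ z :* ((g₀ :+ z :* G₁) :* H :+ (s :* G₁ :+ R₁))))
                   B.refl (ι (ĝ 0)) z G₁ (ι s) H (ι (ρ 0)) R₁ ⟩
            (ι (ĝ 0) B.* ι s B.+ ι (ρ 0)) B.+ z B.* ((ι (ĝ 0) B.+ z B.* G₁) B.* H B.+ (ι s B.* G₁ B.+ R₁))
              ≈⟨ B.+-cong
                   (B.trans (B.+-congʳ (B.sym (ι-* _ _))) (B.trans (B.sym (ι-+ _ _))
                     (ι-cong (x+[y-x]≈y (ĝ 0 * s) 1#))))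
                   (B.*-congˡ {z} (B.trans (B.+-cong (B.*-congʳ (B.sym (eval-head a ĝ))) remainders) D.values)) ⟩
            ι 1# B.+ z B.* eval (suc (b ℕ.+ a)) (ones (b ℕ.+ a))
              ≈⟨ eval-head (suc (b ℕ.+ a)) (ones (suc (b ℕ.+ a))) ⟨
            eval (suc (suc (b ℕ.+ a))) (ones (suc (b ℕ.+ a))) ∎ }
        where
        open SemiringSolver B.commutativeSemiring
        module D = Division (divide a′ g b)
        a : ℕ
        a = suc a′
        ĝ ρ : ℕ → Carrier
        ĝ = monicCoeff K a g
        s : Carrier
        -- The old remainder has degree below `a`, so this is the coefficient of X^a in X ρ; as g is
        -- monic, subtracting s g removes it.
        s = D.remainder a′
        ρ zero = 1# - ĝ 0 * s
        ρ (suc k) = D.remainder k - s * ĝ (suc k)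
        z G G₁ H R₁ : Element
        z = ζ^ 1
        G = eval (suc a) ĝ
        G₁ = eval a (ĝ ∘ suc)
        H = eval (suc b) (monicCoeff K b D.quotient)
        R₁ = eval a (ρ ∘ suc)
        above : ∀ k → a ℕ.≤ k → ρ k ≈ 0#
        above (suc k) (s≤s a′≤k) with ℕ.m≤n⇒m<n∨m≡n a′≤k
        ... | inj₁ a′<k = trans (+-cong (D.remainder-above k a′<k) (-‿cong (trans
                (*-congˡ (reflexive (monicCoeff-above a g (s≤s a′<k)))) (zeroʳ s)))) (-‿inverseʳ 0#)
        ... | inj₂ ≡.refl = trans (+-congˡ (-‿cong (trans
                (*-congˡ (reflexive (monicCoeff-top a g))) (*-identityʳ s)))) (-‿inverseʳ s)
        remainders : ι s B.* G₁ B.+ R₁ B.≈ eval a D.remainder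
        remainders = begin
          ι s B.* G₁ B.+ R₁                          ≈⟨ B.+-congʳ (eval-scale a s (ĝ ∘ suc)) ⟨
          eval a (λ k → s * ĝ (suc k)) B.+ R₁        ≈⟨ eval-+ a (λ k → s * ĝ (suc k)) (ρ ∘ suc) ⟨
          eval a (λ k → s * ĝ (suc k) + ρ (suc k))   ≈⟨ eval-cong a {h = D.remainder} (λ k _ → x+[y-x]≈y (s * ĝ (suc k)) _) ⟩
          eval a D.remainder                         ∎
        coeffs : ∀ k → convolution ĝ (monicCoeff K (suc b) (s ∷ D.quotient)) k + ρ k ≈ ones (suc b ℕ.+ a) k
        coeffs zero = x+[y-x]≈y _ _
        coeffs (suc k) = trans (+-congʳ (convolution-suc ĝ (monicCoeff K (suc b) (s ∷ D.quotient)) k)) (trans (+-assoc _ _ _) (trans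
          (+-congˡ (trans (+-congʳ (*-comm _ _)) (x+[y-x]≈y _ _))) (D.coefficients k)))
  open Eval

  -- A monic polynomial of degree n whose value at ζ kills `b`. For `b` different from 0 these take
  -- the place of the polynomials that vanish at ζ.
  Annihilated : Element → ℕ → Set (c ⊔ ℓ)
  Annihilated b n = Σ (Fin n → Carrier) λ g → eval (suc n) (monicCoeff K n g) B.* b B.≈ B.0#

  module _ (field′ : IsField K) (irreducible : CyclotomicIrreducible K l) where

    private
      -- A nonzero leading coefficient of `ρ` could be scaled to 1, giving a monic annihilator of a
      -- degree that is excluded. Whether a coefficient is zero cannot be decided, hence the double
      -- negation.
      vanishes : ∀ n {b} → (∀ m → m ℕ.< n → ¬ Annihilated b m) → ∀ ρ → eval n ρ B.* b B.≈ B.0# →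
        ¬ ¬ (∀ i → i ℕ.< n → ρ i ≈ 0#)
      vanishes zero minimal ρ e k = k λ i ()
      vanishes (suc n) {b} minimal ρ e k = minimal n ℕ.≤-refl (g , annihilates)
        where
        top≉0 : ¬ ρ n ≈ 0#
        top≉0 top≈0 = vanishes n (λ m m<n → minimal m (ℕ.m≤n⇒m≤1+n m<n)) ρ
          (B.trans (B.*-congʳ (B.sym (eval-last-0 n ρ top≈0))) e)
          λ below → k λ i i≤n → case (ℕ.m≤n⇒m<n∨m≡n (ℕ.≤-pred i≤n)) below
          where
          case : ∀ {i} → i ℕ.< n ⊎ i ≡ n → (∀ i → i ℕ.< n → ρ i ≈ 0#) → ρ i ≈ 0#
          case (inj₁ i<n) below = below _ i<n
          case (inj₂ ≡.refl) below = top≈0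
        y : Carrier
        y = proj₁ (proj₂ field′ (ρ n) top≉0)
        g : Fin n → Carrier
        g = (λ i → y * ρ i) ∘ toℕ
        scaled : ∀ i → i ℕ.< suc n → monicCoeff K n g i ≈ y * ρ i
        scaled i i≤n with ℕ.m≤n⇒m<n∨m≡n (ℕ.≤-pred i≤n)
        ... | inj₁ i<n = reflexive (monicCoeff-toℕ n _ i<n)
        ... | inj₂ ≡.refl = trans (reflexive (monicCoeff-top n g))
                (trans (sym (proj₂ (proj₂ field′ (ρ n) top≉0))) (*-comm _ _))
        annihilates : eval (suc n) (monicCoeff K n g) B.* b B.≈ B.0#
        annihilates = B.trans (B.*-congʳ (B.trans (eval-cong (suc n) scaled) (eval-scale (suc n) y ρ)))
          (B.trans (B.*-assoc _ _ _) (B.trans (B.*-congˡ {ι y} e) (B.zeroʳ _)))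

      -- Strong induction on the degree. Divide the cyclotomic polynomial, which is 0 at ζ, by an
      -- annihilator g of `b`: the remainder kills `b` too, so its coefficients vanish because lower
      -- degrees are excluded, and g becomes a proper factor. In degree 0 the annihilator is 1,
      -- which forces b = 0.
      not-annihilated : ∀ {b} → ¬ b B.≈ B.0# → ∀ n → n ℕ.< r → ¬ Annihilated b n
      not-annihilated {b} b≉0 = <-rec (λ n → n ℕ.< r → ¬ Annihilated b n) step
        where
        step : ∀ n → (∀ {m} → m ℕ.< n → m ℕ.< r → ¬ Annihilated b m) → n ℕ.< r → ¬ Annihilated b n
        step zero ih 0<r (g , e) = b≉0 (B.trans (B.sym (B.trans (B.*-congʳ (eval-one g)) (B.*-identityˡ b))) e)
        step (suc n) ih n<r (g , e) =
          vanishes (suc n) (λ m m<n → ih m<n (ℕ.<-trans m<n n<r)) D.remainder remainder-annihilates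
            λ below → irreducible (suc n) q (s≤s z≤n) (ℕ.m<n⇒0<n∸m n<r) (ℕ.m+[n∸m]≡n (ℕ.<⇒≤ n<r)) g D.quotient
              λ k k≤r → trans (sym (+-identityʳ _)) (trans (+-congˡ (sym (remainder≈0 below k)))
                (trans (D.coefficients k) (reflexive (≡.trans (≡.cong (λ m → ones m k) q+a≡r) (ones-≤ k≤r)))))
          where
          q : ℕ
          q = r ∸ suc n
          q+a≡r : q ℕ.+ suc n ≡ r
          q+a≡r = ℕ.m∸n+n≡m (ℕ.<⇒≤ n<r)
          module D = Division (divide n g q)
          remainder≈0 : (∀ i → i ℕ.< suc n → D.remainder i ≈ 0#) → ∀ k → D.remainder k ≈ 0#
          remainder≈0 below k with k ℕ.<? suc n
          ... | yes k<a = below k k<a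
          ... | no k≮a = D.remainder-above k (ℕ.≮⇒≥ k≮a)
          G H R : Element
          G = eval (suc (suc n)) (monicCoeff K (suc n) g)
          H = eval (suc q) (monicCoeff K q D.quotient)
          R = eval (suc n) D.remainder
          open SetoidReasoning B.setoid
          remainder-annihilates : R B.* b B.≈ B.0#
          remainder-annihilates = begin
            R B.* b                        ≈⟨ B.+-identityˡ _ ⟨
            B.0# B.+ R B.* b               ≈⟨ B.+-congʳ (B.trans (B.*-congˡ {H} e) (B.zeroʳ H)) ⟨
            H B.* (G B.* b) B.+ R B.* b    ≈⟨ solve 4 (λ H G b R → H :* (G :* b) :+ R :* b := (G :* H :+ R) :* b) B.refl H G b R ⟩
            (G B.* H B.+ R) B.* b          ≈⟨ B.*-congʳ D.values ⟩
            eval (suc (q ℕ.+ suc n)) (ones (q ℕ.+ suc n)) B.* b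
              ≈⟨ B.*-congʳ (B.trans (B.reflexive (≡.cong (λ m → eval (suc m) (ones m)) q+a≡r)) eval-ones) ⟩
            B.0# B.* b                     ≈⟨ B.zeroˡ b ⟩
            B.0#                           ∎
            where open SemiringSolver B.commutativeSemiring

    -- Written as a polynomial in ζ of degree below r, `a` kills `b`, so `vanishes` applies to its
    -- coefficients. The goal is a contradiction, and the double negation does no harm.
    no-zero-divisors : ∀ {a b} → a B.* b B.≈ B.0# → ¬ a B.≈ B.0# → ¬ b B.≈ B.0# → ⊥
    no-zero-divisors {a} {b} ab≈0 a≉0 b≉0 =
      vanishes r (λ m m<r → not-annihilated b≉0 m m<r) ρ
        (B.trans (B.*-congʳ (B.sym a≈eval)) ab≈0)
        λ below → a≉0 (differBy (coeff a r) λ t → trans (constant below t)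
          (sym (trans (+-congʳ (reflexive (coeff-0 t))) (+-identityˡ _))))
      where
      -- Subtracting the constant `coeff a r` changes nothing in the ring but removes the term in
      -- ζ^r, which is where the degree falls below r.
      ρ : ℕ → Carrier
      ρ k = coeff a k - coeff a r
      ρ-periodic : Periodic ρ
      ρ-periodic e = +-congʳ (periodic a e)
      a≈eval : a B.≈ eval r ρ
      a≈eval = B.trans (differBy (coeff a r) λ t → sym (trans (+-congʳ (coeff-eval ρ-periodic t))
          (trans (+-comm _ _) (x+[y-x]≈y _ _))))
        (eval-last-0 r ρ (-‿inverseʳ _))
      constant : (∀ i → i ℕ.< r → ρ i ≈ 0#) → ∀ t → coeff a t ≈ coeff a r
      constant below t = trans (sym (x+[y-x]≈y (coeff a r) (coeff a t))) (trans (+-congˡ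
        (trans (ρ-periodic (≋-sym (residue-≋ t))) (at (toℕ (residue t)) (ℕ.≤-pred (toℕ<n (residue t))))))
        (+-identityʳ _))
        where
        at : ∀ i → i ℕ.≤ r → ρ i ≈ 0#
        at i i≤r with ℕ.m≤n⇒m<n∨m≡n i≤r
        ... | inj₁ i<r = below i i<r
        ... | inj₂ ≡.refl = -‿inverseʳ _

-- Powers of a generator modulo the prime l.

module PrimitiveRoot (r γ : ℕ) (prime : Prime (suc r)) (generator : IsGeneratorMod (suc r) γ) where
  open import Data.Nat using (_+_; _*_; _%_; _/_; _<_; _^_; _∸_; pred; ≢-nonZero; >-nonZero)
  open import Data.Nat.Properties
  open import Data.Nat.DivMod
  open Residues r
  open SetoidReasoning ≋-setoid

  *≋0⇒ : ∀ a b → a * b ≋ 0 → a ≋ 0 ⊎ b ≋ 0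
  *≋0⇒ a b e with euclidsLemma a b prime (m%n≡0⇒n∣m (a * b) l (%-eq e))
  ... | inj₁ l∣a = inj₁ (congruent (n∣m⇒m%n≡0 a l l∣a))
  ... | inj₂ l∣b = inj₂ (congruent (n∣m⇒m%n≡0 b l l∣b))

  *-cancelˡ-≋ : ∀ a {x y} → ¬ a ≋ 0 → a * x ≋ a * y → x ≋ y
  *-cancelˡ-≋ a {x} {y} a≢0 e with *≋0⇒ a (x + r * y) (begin
      a * (x + r * y)      ≡⟨ *-distribˡ-+ a x (r * y) ⟩
      a * x + a * (r * y)  ≈⟨ +-≋ e ≋-refl ⟩
      a * y + a * (r * y)  ≡⟨ *-distribˡ-+ a y (r * y) ⟨
      a * (y + r * y)      ≈⟨ *-≋0 a (neg-cancel 0 y) ⟩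
      0                    ∎)
  ... | inj₁ a≋0 = contradiction a≋0 a≢0
  ... | inj₂ e′ = ≋-sym (+-cancelʳ-≋ (r * y) (≋-trans (neg-cancel 0 y) (≋-sym e′)))

  γ≢0 : ¬ γ ≋ 0
  γ≢0 e = proj₁ generator (%-eq e)

  1≢0 : ¬ 1 ≋ 0
  1≢0 e = γ≢0 (≋-trans (≡⇒≋ (≡.sym (*-identityʳ γ))) (*-≋0 γ e))

  ^≢0 : ∀ k → ¬ γ ^ k ≋ 0
  ^≢0 zero = 1≢0
  ^≢0 (suc k) e with *≋0⇒ γ (γ ^ k) e
  ... | inj₁ e′ = γ≢0 e′
  ... | inj₂ e′ = ^≢0 k e′

  logarithm : ∀ {t} → ¬ t ≋ 0 → ∃ λ k → γ ^ k ≋ t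
  logarithm {t} t≢0 with proj₂ generator (t % l) (n≢0⇒n>0 (t≢0 ∘ congruent)) (m%n<n t l)
  ... | k , e = k , congruent e

  ^-% : ∀ {a d} .{{_ : ℕ.NonZero d}} → a ^ d ≋ 1 → ∀ k → a ^ k ≋ a ^ (k % d)
  ^-% {a} {d} e k = begin
    a ^ k                               ≡⟨ ≡.cong (a ^_) (m≡m%n+[m/n]*n k d) ⟩
    a ^ (k % d + k / d * d)             ≡⟨ ^-distribˡ-+-* a (k % d) (k / d * d) ⟩
    a ^ (k % d) * a ^ (k / d * d)       ≡⟨ ≡.cong (λ m → a ^ (k % d) * a ^ m) (*-comm (k / d) d) ⟩
    a ^ (k % d) * a ^ (d * (k / d))     ≡⟨ ≡.cong (a ^ (k % d) *_) (≡.sym (^-*-assoc a d (k / d))) ⟩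
    a ^ (k % d) * (a ^ d) ^ (k / d)     ≈⟨ *-≋ (≋-refl {a ^ (k % d)}) (^-≋ (k / d) e) ⟩
    a ^ (k % d) * 1 ^ (k / d)           ≡⟨ ≡.cong (a ^ (k % d) *_) (^-zeroˡ (k / d)) ⟩
    a ^ (k % d) * 1                     ≡⟨ *-identityʳ _ ⟩
    a ^ (k % d)                         ∎

  private
    log : (i : Fin r) → ∃ λ k → γ ^ k ≋ suc (toℕ i)
    log i = logarithm λ e → 1+n≢0 (≋⇒≡ (s≤s (toℕ<n i)) (s≤s z≤n) e)

    pred<r : ∀ k → pred (γ ^ k % l) < r
    pred<r k = ≤-trans (≤-reflexive (suc-pred (γ ^ k % l) {{≢-nonZero (^≢0 k ∘ congruent)}}))
                       (≤-pred (m%n<n (γ ^ k) l))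

    γ^[j-i]≋1 : ∀ {i j : Fin l} → i Fin.< j →
      fromℕ< (pred<r (toℕ i)) ≡ fromℕ< (pred<r (toℕ j)) → γ ^ (toℕ j ∸ toℕ i) ≋ 1
    γ^[j-i]≋1 {i} {j} i<j eq = *-cancelˡ-≋ (γ ^ toℕ i) (^≢0 (toℕ i)) (begin
      γ ^ toℕ i * γ ^ (toℕ j ∸ toℕ i)  ≡⟨ ^-distribˡ-+-* γ (toℕ i) _ ⟨
      γ ^ (toℕ i + (toℕ j ∸ toℕ i))    ≡⟨ ≡.cong (γ ^_) (m+[n∸m]≡n (<⇒≤ i<j)) ⟩
      γ ^ toℕ j                        ≈⟨ congruent (pred-injective {{nonZero j}} {{nonZero i}}
        (≡.trans (≡.sym (toℕ-fromℕ< (pred<r (toℕ j))))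
        (≡.trans (≡.cong toℕ (≡.sym eq)) (toℕ-fromℕ< (pred<r (toℕ i)))))) ⟩
      γ ^ toℕ i                        ≡⟨ *-identityʳ _ ⟨
      γ ^ toℕ i * 1                    ∎)
      where
      nonZero : ∀ (k : Fin l) → ℕ.NonZero (γ ^ toℕ k % l)
      nonZero k = ≢-nonZero (^≢0 (toℕ k) ∘ congruent)

  -- Otherwise the exponents matter only modulo d, and two of the r nonzero residues, all of them
  -- powers of γ, would share an exponent and coincide.
  order-minimal : ∀ d → 0 < d → d < r → ¬ γ ^ d ≋ 1
  order-minimal d@(suc _) _ d<r e
    with i , j , i<j , eq ← pigeonhole d<r (λ i → fromℕ< (m%n<n (proj₁ (log i)) d))
    = <⇒≢ i<j (suc-injective (≋⇒≡ (s≤s (toℕ<n i)) (s≤s (toℕ<n j)) (begin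
      suc (toℕ i)                 ≈⟨ proj₂ (log i) ⟨
      γ ^ proj₁ (log i)           ≈⟨ ^-% e (proj₁ (log i)) ⟩
      γ ^ (proj₁ (log i) % d)     ≡⟨ ≡.cong (γ ^_) (≡.trans (≡.sym (toℕ-fromℕ< (m%n<n (proj₁ (log i)) d)))
                                       (≡.trans (≡.cong toℕ eq) (toℕ-fromℕ< (m%n<n (proj₁ (log j)) d)))) ⟩
      γ ^ (proj₁ (log j) % d)     ≈⟨ ^-% e (proj₁ (log j)) ⟨
      γ ^ proj₁ (log j)           ≈⟨ proj₂ (log j) ⟩
      suc (toℕ j)                 ∎)))

  -- Among the exponents 0, ..., r two give the same of the r nonzero residues, so γ^d ≋ 1 for some
  -- 0 < d ≤ r, and `order-minimal` leaves only d = r.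
  γ^r≋1 : γ ^ r ≋ 1
  γ^r≋1
    with i , j , i<j , eq ← pigeonhole (n<1+n r) (λ (k : Fin l) → fromℕ< (pred<r (toℕ k)))
    with m≤n⇒m<n∨m≡n (≤-trans (m∸n≤m (toℕ j) (toℕ i)) (≤-pred (toℕ<n j)))
  ... | inj₁ d<r = contradiction (γ^[j-i]≋1 i<j eq) (order-minimal _ (m<n⇒0<n∸m i<j) d<r)
  ... | inj₂ d≡r = ≋-trans (≡⇒≋ (≡.cong (γ ^_) (≡.sym d≡r))) (γ^[j-i]≋1 i<j eq)

  inverse : ∀ {a} → ¬ a ≋ 0 → ∃ λ a′ → a * a′ ≋ 1
  inverse {a} a≢0 with k , e ← logarithm a≢0 = (γ ^ k) ^ pred r , (begin
    a * (γ ^ k) ^ pred r        ≈⟨ *-≋ (≋-sym e) ≋-refl ⟩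
    (γ ^ k) ^ suc (pred r)      ≡⟨ ≡.cong ((γ ^ k) ^_) (suc-pred r {{>-nonZero 0<r}}) ⟩
    (γ ^ k) ^ r                 ≡⟨ ^-comm k r ⟩
    (γ ^ r) ^ k                 ≈⟨ ^-≋ k γ^r≋1 ⟩
    1 ^ k                       ≡⟨ ^-zeroˡ k ⟩
    1                           ∎)
    where
    0<r : 0 < r
    0<r = n≢0⇒n>0 λ { ≡.refl → 1≢0 (congruent ≡.refl) }
    ^-comm : ∀ k r → (γ ^ k) ^ r ≡ (γ ^ r) ^ k
    ^-comm k r = ≡.trans (^-*-assoc γ k r) (≡.trans (≡.cong (γ ^_) (*-comm k r)) (≡.sym (^-*-assoc γ r k)))

-- Vectors as ring elements: T_t as a norm coefficient, φ_d as a product.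

module Coordinates {c ℓ} (K : CommutativeRing c ℓ) (r : ℕ) where
  open CommutativeRing K hiding (zero)
  open FiniteSums K
  open Residues r
  open PeriodicSums K
  open Cyclotomic K r
  open RingProperties ring using (-‿+-comm; -‿distribˡ-*; -‿distribʳ-*; -‿involutive)
  open CommSemigroup +-commutativeSemigroup using () renaming (interchange to +-interchange)
  open CommSemigroup *-commutativeSemigroup using () renaming (x∙yz≈y∙xz to *-x∙yz≈y∙xz)
  open SetoidReasoning setoid

  getV-toℕ : ∀ n (x : Vec K n) i → getV K n x (toℕ i) ≡ x i
  getV-toℕ (suc n) x Fin.zero = ≡.refl
  getV-toℕ (suc n) x (Fin.suc i) = getV-toℕ n (x ∘ Fin.suc) i

  sub-≋ : ∀ x {a b} → a ≋ b → sub K l x a ≡ sub K l x b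
  sub-≋ x {a} {b} (congruent e) with a ℕ.% l | b ℕ.% l | e
  ... | zero | zero | _ = ≡.refl
  ... | suc i | suc i | ≡.refl = ≡.refl

  sub-suc : ∀ x (i : Fin r) → sub K l x (suc (toℕ i)) ≡ x i
  sub-suc x i with suc (toℕ i) ℕ.% l | m<n⇒m%n≡m (s≤s (toℕ<n i))
  ... | suc _ | ≡.refl = getV-toℕ r x i

  embed : Vec K r → Element
  embed x = element (sub K l x) λ e → reflexive (sub-≋ x e)

  periodic-ext : ∀ {g h} → Periodic g → Periodic h → g 0 ≈ h 0 →
    (∀ (i : Fin r) → g (suc (toℕ i)) ≈ h (suc (toℕ i))) → ∀ t → g t ≈ h t
  periodic-ext {g} {h} pg ph z s t =
    trans (pg (≋-sym (residue-≋ t))) (trans (at (residue t)) (ph (residue-≋ t)))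
    where
    at : ∀ (i : Fin l) → g (toℕ i) ≈ h (toℕ i)
    at Fin.zero = z
    at (Fin.suc i) = s i

  -- The coordinates of p in the basis ζ, …, ζ^{l-1}, using 1 = -ζ - ⋯ - ζ^{l-1}.
  coordinates : Element → Vec K r
  coordinates p i = coeff p (suc (toℕ i)) - coeff p 0

  embed-≈ : ∀ {x p} → (∀ i → x i ≈ coordinates p i) → embed x ≈ᴮ p
  embed-≈ {x} {p} e = differBy (- coeff p 0) (periodic-ext (periodic (embed x)) (λ q → +-congʳ (periodic p q))
    (sym (-‿inverseʳ _)) (λ i → trans (reflexive (sub-suc x i)) (e i)))

  embed-linear : ∀ a x y t → coeff (embed (axpy K a x y)) t ≈ a * coeff (embed x) t + coeff (embed y) t
  embed-linear a x y = periodic-ext (periodic (embed _))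
    (λ q → +-cong (*-congˡ (periodic (embed x) q)) (periodic (embed y) q))
    (sym (trans (+-identityʳ _) (zeroʳ a)))
    (λ i → trans (reflexive (sub-suc _ i))
      (sym (+-cong (*-congˡ (reflexive (sub-suc x i))) (reflexive (sub-suc y i)))))

  -- The convention x₀ = 0 fixes the representative: comparing coefficients at 0 shows that the
  -- constant is 0.
  embed-injective₀ : ∀ {x} → embed x ≈ᴮ 0ᴮ → ∀ i → x i ≈ 0#
  embed-injective₀ {x} (differBy d e) i = trans (reflexive (≡.sym (sub-suc x i)))
    (trans (e (suc (toℕ i))) (trans (+-congˡ (sym d≈)) (trans (+-identityʳ _) (reflexive (coeff-0 _)))))
    where
    d≈ : 0# ≈ d
    d≈ = trans (e 0) (trans (+-congʳ (reflexive (coeff-0 0))) (+-identityˡ d))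

  sumFin-∑ : ∀ n (g : Fin n → Carrier) → sumFin K n g ≈ ∑ n g
  sumFin-∑ zero g = sym (reflexive ∑-zero)
  sumFin-∑ (suc n) g = trans (+-congˡ (sumFin-∑ n _)) (sym (reflexive ∑-suc))

  sumTuples-cong : ∀ n {g h} → (∀ is → g is ≈ h is) → sumTuples K n l g ≈ sumTuples K n l h
  sumTuples-cong zero e = e _
  sumTuples-cong (suc n) e = trans (sumFin-∑ l _) (trans
    (∑-cong λ a → sumTuples-cong n λ is → e (a ∷ is)) (sym (sumFin-∑ l _)))

  *-sumTuples : ∀ n x {g} → x * sumTuples K n l g ≈ sumTuples K n l (λ is → x * g is)
  *-sumTuples zero x = refl
  *-sumTuples (suc n) x {g} = trans (*-congˡ (sumFin-∑ l _)) (trans (*-∑ x)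
    (trans (∑-cong λ a → *-sumTuples n x {λ is → g (a ∷ is)}) (sym (sumFin-∑ l _))))

  private
    -- Recovers the summand of T, which is a local definition there.
    summandOf : ∀ {n g} {z : Carrier} → z ≡ sumTuples K n l g → (Fin n → Fin l) → Carrier
    summandOf {g = g} _ = g

    T-summand : ∀ n β t → Vec K r → (Fin n → Fin l) → Carrier
    T-summand n β t x = summandOf {z = T K n l β t x} ≡.refl

    T-summand-δ : ∀ n β t x is → T-summand n β t x is
      ≈ δ t (weightedSum K n l β is) * prodFin K n (λ j → sub K l x (toℕ (is j)))
    T-summand-δ n β t x is with weightedSum K n l β is ℕ.% l ℕ.≟ t ℕ.% l
    ... | yes e = sym (trans (*-congʳ (δ-true (congruent (≡.sym e)))) (*-identityˡ _))
    ... | no ¬e = sym (trans (*-congʳ (δ-false (¬e ∘ ≡.sym ∘ %-eq))) (zeroˡ _))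

  T-δ : ∀ n β t x → T K n l β t x
    ≈ sumTuples K n l (λ is → δ t (weightedSum K n l β is) * prodFin K n (λ j → sub K l x (toℕ (is j))))
  T-δ n β t x = sumTuples-cong n (T-summand-δ n β t x)

  -- `ψ` acts on the index of a coefficient, so the automorphism ζ ↦ ζ^β is `ψ` at the inverse of β.
  module Conjugation (β β′ : ℕ) (unit : β′ ℕ.* β ≋ 1) where
    open Permanent cyclotomicRing (ψ β′) (ψ-hom β′ β unit) public

    -- The condition a + β w ≡ t on the first index a and the weighted sum w of the others reads w ≡
    -- β′(t - a). The inner sum is thus a norm coefficient at β′(t - a), that is, a coefficient of
    -- its σ-conjugate at t - a, and summing over a is a convolution.
    T-norm : ∀ n t x → T K n l β t x ≈ coeff (norm n (embed x)) t
    T-norm zero t x = trans (T-δ 0 β t x) (trans (*-identityʳ _) (sym (reflexive (coeff-ζ^ 0 t))))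
    T-norm (suc n) t x = begin
      T K (suc n) l β t x
        ≈⟨ trans (T-δ (suc n) β t x) (sumFin-∑ l _) ⟩
      ∑[ a < l ] sumTuples K n l (λ is → δ t (toℕ a ℕ.+ β ℕ.* w is) * (X (toℕ a) * π is))
        ≈⟨ ∑-cong (λ a → begin
             sumTuples K n l (λ is → δ t (toℕ a ℕ.+ β ℕ.* w is) * (X (toℕ a) * π is))
               ≈⟨ sumTuples-cong n (λ is → trans (*-x∙yz≈y∙xz _ _ _) (*-congˡ (*-congʳ
                    (δ-cong (solve-for (toℕ a) (w is)) (unsolve-for (toℕ a) (w is)))))) ⟩
             sumTuples K n l (λ is → X (toℕ a) * (δ (β′ ℕ.* (t ℕ.+ r ℕ.* toℕ a)) (w is) * π is))
               ≈⟨ *-sumTuples n (X (toℕ a)) ⟨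
             X (toℕ a) * sumTuples K n l (λ is → δ (β′ ℕ.* (t ℕ.+ r ℕ.* toℕ a)) (w is) * π is)
               ≈⟨ *-congˡ (trans (sym (T-δ n β _ x)) (T-norm n _ x)) ⟩
             X (toℕ a) * coeff (norm n (embed x)) (β′ ℕ.* (t ℕ.+ r ℕ.* toℕ a))
               ≈⟨ *-congˡ (reflexive (≡.sym (coeff-ψ β′ (norm n (embed x)) _))) ⟩
             X (toℕ a) * coeff (ψ β′ (norm n (embed x))) (t ℕ.+ r ℕ.* toℕ a) ∎) ⟩
      ∑[ a < l ] (X (toℕ a) * coeff (ψ β′ (norm n (embed x))) (t ℕ.+ r ℕ.* toℕ a))
        ≡⟨ coeff-* (embed x) (ψ β′ (norm n (embed x))) t ⟨
      coeff (norm (suc n) (embed x)) t ∎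
      where
      X : ℕ → Carrier
      X = sub K l x
      w : (Fin n → Fin l) → ℕ
      w = weightedSum K n l β
      π : (Fin n → Fin l) → Carrier
      π is = prodFin K n (λ j → X (toℕ (is j)))
      solve-for : ∀ a w → t ≋ a ℕ.+ β ℕ.* w → β′ ℕ.* (t ℕ.+ r ℕ.* a) ≋ w
      solve-for a w e = ≋-trans (*-≋ (≋-refl {β′}) (≋-sym (a+b≋c⇒a≋c-b {β ℕ.* w} {a} {t}
        (≋-trans (≡⇒≋ (ℕ.+-comm (β ℕ.* w) a)) (≋-sym e))))) (unit-cancel β′ β unit w)
      unsolve-for : ∀ a w → β′ ℕ.* (t ℕ.+ r ℕ.* a) ≋ w → t ≋ a ℕ.+ β ℕ.* w
      unsolve-for a w e = ≋-trans (≋-sym (a≋c-b⇒a+b≋c {β ℕ.* w} {a} {t}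
        (≋-trans (*-≋ (≋-refl {β}) (≋-sym e)) (unit-cancel β β′ (unit-swap β′ β unit) _))))
        (≡⇒≋ (ℕ.+-comm (β ℕ.* w) a))

    norm-ι : ∀ n x → norm n (ι x) ≈ᴮ ι (powK K x n)
    norm-ι zero x = B.sym ι-1
    norm-ι (suc n) x = B.trans (B.*-congˡ {ι x} (B.trans (σ-cong (norm-ι n x)) (ψ-ι β′ β unit _)))
      (B.sym (ι-* x _))

  powK-cong : ∀ n {x y} → x ≈ y → powK K x n ≈ powK K y n
  powK-cong zero e = refl
  powK-cong (suc n) e = *-cong e (powK-cong n e)

  powK-1 : ∀ n → powK K 1# n ≈ 1#
  powK-1 zero = refl
  powK-1 (suc n) = trans (*-identityˡ _) (powK-1 n)

  private
    sign-cases : ∀ m → powK K (- 1#) m ≈ 1# ⊎ (powK K (- 1#) m ≈ - 1# × powK K (- 1#) (suc m) ≈ 1#)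
    sign-cases zero = inj₁ refl
    sign-cases (suc m) with sign-cases m
    ... | inj₁ e = inj₂ (e′ , trans (*-congˡ e′)
            (trans (sym (-‿distribˡ-* _ _)) (trans (-‿cong (*-identityˡ _)) (-‿involutive 1#))))
      where
      e′ : powK K (- 1#) (suc m) ≈ - 1#
      e′ = trans (*-congˡ e) (*-identityʳ _)
    ... | inj₂ (_ , e) = inj₁ e

  -- m (m + 1) is even. With f = m + 1 this says that the sign in φ_d has norm 1.
  sign-power : ∀ m → powK K (powK K (- 1#) m) (suc m) ≈ 1#
  sign-power m with sign-cases m
  ... | inj₁ e = trans (powK-cong (suc m) e) (powK-1 (suc m))
  ... | inj₂ (e , e′) = trans (powK-cong (suc m) e) e′

  negMod-≋ : ∀ a → negMod l a ≋ r ℕ.* a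
  negMod-≋ a = ≋-trans (%-≋ _) (≋-trans
    (a+b≋c⇒a≋c-b {l ∸ a ℕ.% l} {a ℕ.% l} {0} (≋-trans (≡⇒≋ (≡.trans (ℕ.m∸n+n≡m (m%n≤n a l))
      (≡.sym (ℕ.*-identityˡ l)))) (l≋0 1)))
    (*-≋ (≋-refl {r}) (%-≋ a)))

  module Product (m dinv : ℕ) where
    sign : Carrier
    sign = powK K (- 1#) m

    product : Vec K r → Vec K r → Element
    product x y = ι sign B.* (ψ (r ℕ.* dinv) (embed x) B.* embed y)

    private
      convolution : Vec K r → Vec K r → ℕ → Carrier
      convolution x y t = ∑[ i < r ]
        (coeff (embed x) (negMod l (dinv ℕ.* suc (toℕ i))) * coeff (embed y) (t ℕ.+ negMod l (suc (toℕ i))))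

      coeff-product : ∀ x y t → coeff (product x y) t ≈ sign * convolution x y t
      coeff-product x y t = trans (ι-*ᴮ sign _ t) (*-congˡ (begin
        coeff (ψ (r ℕ.* dinv) (embed x) B.* embed y) t
          ≡⟨ ≡.trans (coeff-* _ _ t) ∑-suc ⟩
        coeff (ψ (r ℕ.* dinv) (embed x)) 0 * coeff (embed y) (t ℕ.+ r ℕ.* 0)
          + ∑[ i < r ] (coeff (ψ (r ℕ.* dinv) (embed x)) (suc (toℕ i)) * coeff (embed y) (t ℕ.+ r ℕ.* suc (toℕ i)))
          -- The term i = 0 disappears because x₀ = 0, so the convolution starts at i = 1 as in φ_d.
          ≈⟨ +-cong
               (trans (*-congʳ (trans (reflexive (coeff-ψ (r ℕ.* dinv) (embed x) 0))
                 (periodic (embed x) (≡⇒≋ (ℕ.*-zeroʳ (r ℕ.* dinv)))))) (zeroˡ _))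
               (∑-cong λ i → *-cong
                 (trans (reflexive (coeff-ψ (r ℕ.* dinv) (embed x) _)) (periodic (embed x)
                   (≋-trans (≡⇒≋ (ℕ.*-assoc r dinv _)) (≋-sym (negMod-≋ _)))))
                 (periodic (embed y) (+-≋ (≋-refl {t}) (≋-sym (negMod-≋ _))))) ⟩
        0# + convolution x y t
          ≈⟨ +-identityˡ _ ⟩
        convolution x y t ∎))

      convolution-linearˡ : ∀ a x x′ y t →
        convolution (axpy K a x x′) y t ≈ a * convolution x y t + convolution x′ y t
      convolution-linearˡ a x x′ y t = trans
        (∑-cong λ i → trans (*-congʳ (embed-linear a x x′ (negMod l (dinv ℕ.* suc (toℕ i))))) (trans (distribʳ _ _ _) (+-congʳ (*-assoc _ _ _))))
        (trans ∑-+ (+-congʳ (sym (*-∑ a))))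

      convolution-linearʳ : ∀ a x y y′ t →
        convolution x (axpy K a y y′) t ≈ a * convolution x y t + convolution x y′ t
      convolution-linearʳ a x y y′ t = trans
        (∑-cong λ i → trans (*-congˡ (embed-linear a y y′ (t ℕ.+ negMod l (suc (toℕ i))))) (trans (distribˡ _ _ _) (+-congʳ (*-x∙yz≈y∙xz _ _ _))))
        (trans ∑-+ (+-congʳ (sym (*-∑ a))))

      phi-convolution : ∀ x y k → phi K (suc m) l dinv x y k
        ≈ sign * (convolution x y (suc (toℕ k)) - convolution x y 0)
      phi-convolution x y k = *-congˡ (+-cong (sumFin-∑ r _) (-‿cong (sumFin-∑ r _)))

      difference-linear : ∀ s a {u u₁ u₂ w w₁ w₂} → u ≈ a * u₁ + u₂ → w ≈ a * w₁ + w₂ →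
        s * (u - w) ≈ a * (s * (u₁ - w₁)) + s * (u₂ - w₂)
      difference-linear s a {u} {u₁} {u₂} {w} {w₁} {w₂} eu ew = begin
        s * (u - w)
          ≈⟨ *-congˡ (+-cong eu (trans (-‿cong ew) (sym (-‿+-comm _ _)))) ⟩
        s * ((a * u₁ + u₂) + (- (a * w₁) - w₂))
          ≈⟨ *-congˡ (+-interchange _ _ _ _) ⟩
        s * ((a * u₁ - a * w₁) + (u₂ - w₂))
          ≈⟨ trans (distribˡ _ _ _) (+-congʳ (*-congˡ (+-congˡ (-‿distribʳ-* a w₁)))) ⟩
        s * (a * u₁ + a * (- w₁)) + s * (u₂ - w₂)
          ≈⟨ +-congʳ (trans (*-congˡ (sym (distribˡ a _ _))) (*-x∙yz≈y∙xz _ _ _)) ⟩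
        a * (s * (u₁ - w₁)) + s * (u₂ - w₂) ∎

    phi-bilinear : IsBilinear K (phi K (suc m) l dinv)
    phi-bilinear =
      (λ a x x′ y k → trans (phi-convolution _ y k) (trans
        (difference-linear sign a (convolution-linearˡ a x x′ y (suc (toℕ k))) (convolution-linearˡ a x x′ y 0))
        (sym (+-cong (*-congˡ (phi-convolution x y k)) (phi-convolution x′ y k))))) ,
      (λ a x y y′ k → trans (phi-convolution x _ k) (trans
        (difference-linear sign a (convolution-linearʳ a x y y′ (suc (toℕ k))) (convolution-linearʳ a x y y′ 0))
        (sym (+-cong (*-congˡ (phi-convolution x y k)) (phi-convolution x y′ k)))))

    -- The second sum of φ_d is the coefficient of the product at 0; subtracting it passes to the
    -- representative with coefficient 0 there.
    embed-phi : ∀ x y → embed (phi K (suc m) l dinv x y) ≈ᴮ product x y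
    embed-phi x y = embed-≈ λ k → trans (phi-convolution x y k) (trans (distribˡ _ _ _) (+-cong
      (sym (coeff-product x y (suc (toℕ k)))) (trans (sym (-‿distribʳ-* _ _)) (-‿cong (sym (coeff-product x y 0))))))

-- V as the locus of scalar norms, and multiplicativity of h on it.

module NormForm {c ℓ} (K : CommutativeRing c ℓ) (r e m γ : ℕ) (r≡ef : r ≡ e ℕ.* suc m)
  (prime : Prime (suc r)) (generator : IsGeneratorMod (suc r) γ) where
  open CommutativeRing K hiding (zero)
  open Residues r
  open Cyclotomic K r
  open PrimitiveRoot r γ prime generator
  open Coordinates K r
  open GroupProperties +-group using () renaming (x∙y⁻¹≈ε⇒x≈y to x-y≈0⇒x≈y; x≈y⇒x∙y⁻¹≈ε to x≈y⇒x-y≈0)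

  -- β has β^f = γ^{ef} = γ^r ≋ 1, so its power with exponent m = f - 1 is its inverse.
  f β β′ : ℕ
  f = suc m
  β = γ ^ e
  β′ = β ^ m

  0<r : 0 ℕ.< r
  0<r = ℕ.n≢0⇒n>0 λ { ≡.refl → 1≢0 (congruent ≡.refl) }

  0<e : 0 ℕ.< e
  0<e = ℕ.n≢0⇒n>0 λ { ≡.refl → contradiction 0<r (λ 0<r → ℕ.<⇒≢ 0<r (≡.sym r≡ef)) }

  β^f≋1 : β ^ f ≋ 1
  β^f≋1 = ≋-trans (≡⇒≋ (≡.trans (ℕ.^-*-assoc γ e f) (≡.cong (γ ^_) (≡.sym r≡ef)))) γ^r≋1

  β-unit : β′ ℕ.* β ≋ 1
  β-unit = ≋-trans (≡⇒≋ (ℕ.*-comm β′ β)) β^f≋1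

  open Conjugation β β′ β-unit public

  σ^-ψ : ∀ n p → σ^ n p ≈ᴮ ψ (β′ ^ n) p
  σ^-ψ zero p = B.sym (ψ-1 p)
  σ^-ψ (suc n) p = B.trans (σ-cong (σ^-ψ n p)) (ψ-∘ β′ (β′ ^ n) p)

  σ^f≈id : ∀ p → σ^ f p ≈ᴮ p
  σ^f≈id p = B.trans (σ^-ψ f p) (B.trans (ψ-≋ β′^f≋1 p) (ψ-1 p))
    where
    β′^f≋1 : β′ ^ f ≋ 1
    β′^f≋1 = ≋-trans (≡⇒≋ (≡.trans (ℕ.^-*-assoc β m f) (≡.trans (≡.cong (β ^_) (ℕ.*-comm m f))
      (≡.sym (ℕ.^-*-assoc β f m))))) (≋-trans (^-≋ m β^f≋1) (≡⇒≋ (ℕ.^-zeroˡ m)))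

  -- A priori the coefficients agree only up to a constant; index 0 is fixed by multiplication by
  -- `a`, so comparison there shows that the constant is 0.
  ψ-fixed-coeff : ∀ a {p} → ψ a p ≈ᴮ p → ∀ t → coeff p (a ℕ.* t) ≈ coeff p t
  ψ-fixed-coeff a {p} (differBy d e) t =
    trans (at t) (trans (+-congˡ (sym 0≈d)) (+-identityʳ _))
    where
    at : ∀ t → coeff p (a ℕ.* t) ≈ coeff p t + d
    at t = trans (reflexive (≡.sym (coeff-ψ a p t))) (e t)
    0≈d : 0# ≈ d
    0≈d = trans (sym (-‿inverseˡ (coeff p 0))) (trans
      (+-congˡ (trans (periodic p (≡⇒≋ (≡.sym (ℕ.*-zeroʳ a)))) (at 0)))
      (trans (sym (+-assoc _ _ _)) (trans (+-congʳ (-‿inverseˡ _)) (+-identityˡ d))))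

  scalar-if-constant-off-0 : ∀ {p} → (∀ t → ¬ t ≋ 0 → coeff p t ≈ coeff p γ) → p ≈ᴮ ι (functional γ p)
  scalar-if-constant-off-0 {p} constant = differBy (coeff p γ) at
    where
    at : ∀ t → coeff p t ≈ coeff (ι (functional γ p)) t + coeff p γ
    at t with t ≋? 0
    ... | yes t≋0 = trans (periodic p t≋0) (sym (trans (+-congʳ (trans (reflexive (coeff-ι _ t))
            (trans (*-congˡ (δ-true t≋0)) (*-identityʳ _)))) (trans (+-assoc _ _ _)
            (trans (+-congˡ (-‿inverseˡ _)) (+-identityʳ _)))))
    ... | no t≢0 = trans (constant t t≢0) (sym (trans (+-congʳ (trans (reflexive (coeff-ι _ t))
            (trans (*-congˡ (δ-false t≢0)) (zeroʳ _)))) (+-identityˡ _)))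

  N : Vec K r → Element
  N x = norm f (embed x)

  hForm-functional : ∀ x → hForm K f l e γ x ≈ functional γ (N x)
  hForm-functional x = +-cong (T-norm f 0 x) (-‿cong (T-norm f γ x))

  private
    hComp-coeff : ∀ x k → hComp K f l e γ k x ≈ coeff (N x) (γ ^ k) - coeff (N x) (γ ^ (k ℕ.+ 1))
    hComp-coeff x k = +-cong (T-norm f _ x) (-‿cong (T-norm f _ x))

    β-step : ∀ x t → coeff (N x) (β ℕ.* t) ≈ coeff (N x) t
    β-step x t = trans (sym (ψ-fixed-coeff β′ (norm-invariant f (embed x) (σ^f≈id _)) (β ℕ.* t)))
      (periodic (N x) (unit-cancel β′ β β-unit t))

  -- The equations of V link the coefficients at γ, γ², ..., γ^e, and these exponents represent all
  -- exponents modulo e. Multiplication by β = γ^e, which preserves the coefficients of N x, reaches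
  -- every other nonzero residue.
  InV⇒scalar : ∀ {x} → InV K f l e γ x → N x ≈ᴮ ι (hForm K f l e γ x)
  InV⇒scalar {x} inV = B.trans (scalar-if-constant-off-0 constant) (ι-cong (sym (hForm-functional x)))
    where
    n : ℕ → Carrier
    n = coeff (N x)
    chain : ∀ k → k ℕ.< e → n (γ ^ suc k) ≈ n γ
    chain zero k<e = periodic (N x) (≡⇒≋ (ℕ.^-identityʳ γ))
    chain (suc k) k<e = trans (sym (trans
      (x-y≈0⇒x≈y _ _ (trans (sym (hComp-coeff x (suc k))) (inV (suc k) (s≤s z≤n) k<e)))
      (reflexive (≡.cong (λ j → n (γ ^ j)) (ℕ.+-comm (suc k) 1)))))
      (chain k (ℕ.<-trans (ℕ.n<1+n k) k<e))
    multiples : ∀ j k → k ℕ.< e → n (γ ^ (j ℕ.* e ℕ.+ suc k)) ≈ n γ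
    multiples zero k k<e = chain k k<e
    multiples (suc j) k k<e = trans
      (reflexive (≡.cong n (≡.trans (≡.cong (γ ^_) (ℕ.+-assoc e (j ℕ.* e) (suc k)))
        (ℕ.^-distribˡ-+-* γ e _))))
      (trans (β-step x (γ ^ (j ℕ.* e ℕ.+ suc k))) (multiples j k k<e))
    powers : ∀ k → n (γ ^ suc k) ≈ n γ
    powers k = trans (reflexive (≡.cong (λ j → n (γ ^ j)) (begin
      suc k                                        ≡⟨ ≡.cong suc (m≡m%n+[m/n]*n k e) ⟩
      suc (k ℕ.% e) ℕ.+ k ℕ./ e ℕ.* e              ≡⟨ ℕ.+-comm (suc (k ℕ.% e)) _ ⟩
      k ℕ./ e ℕ.* e ℕ.+ suc (k ℕ.% e)              ∎)))
      (multiples (k ℕ./ e) (k ℕ.% e) (m%n<n k e))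
      where
      open ≡.≡-Reasoning
      instance
        e-nonZero : ℕ.NonZero e
        e-nonZero = ℕ.>-nonZero 0<e
    constant : ∀ t → ¬ t ≋ 0 → n t ≈ n γ
    constant t t≢0 with logarithm t≢0
    ... | suc k , γ^k≋t = trans (periodic (N x) (≋-sym γ^k≋t)) (powers k)
    -- The chain starts at γ¹, so the exponent 0 is traded for r.
    ... | zero , 1≋t = trans (periodic (N x) (≋-trans (≋-sym 1≋t) (≋-trans (≋-sym γ^r≋1)
            (≡⇒≋ (≡.cong (γ ^_) (≡.sym (ℕ.suc-pred r {{ℕ.>-nonZero 0<r}}))))))) (powers (ℕ.pred r))

  scalar⇒InV : ∀ {x a} → N x ≈ᴮ ι a → InV K f l e γ x
  scalar⇒InV {x} {a} (differBy d eq) k _ _ =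
    trans (hComp-coeff x k) (x≈y⇒x-y≈0 (trans (off-0 k) (sym (off-0 (k ℕ.+ 1)))))
    where
    off-0 : ∀ k → coeff (N x) (γ ^ k) ≈ d
    off-0 k = trans (eq (γ ^ k)) (trans (+-congʳ (trans (reflexive (coeff-ι a _))
      (trans (*-congˡ (δ-false (^≢0 k))) (zeroʳ a)))) (+-identityˡ d))

  scalar⇒hForm : ∀ {x a} → N x ≈ᴮ ι a → hForm K f l e γ x ≈ a
  scalar⇒hForm {x} {a} eq =
    trans (hForm-functional x) (trans (functional-cong γ eq) (functional-ι γ≢0 a))

  module _ (d dinv : ℕ) (dinv-unit : d ℕ.* dinv ≋ 1) where
    open Product m dinv

    -- N(±ψ(X)Y) = ψ(N X) N Y, and ψ fixes the scalar N X.
    norm-phi : ∀ {x y} → InV K f l e γ x → InV K f l e γ y →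
      N (phi K f l dinv x y) ≈ᴮ ι (hForm K f l e γ x * hForm K f l e γ y)
    norm-phi {x} {y} inV-x inV-y = begin
      N (phi K f l dinv x y)
        ≈⟨ norm-cong f (embed-phi x y) ⟩
      norm f (ι sign B.* (τ (embed x) B.* embed y))
        ≈⟨ B.trans (norm-* f _ _) (B.*-cong (norm-ι f sign) (norm-* f _ _)) ⟩
      ι (powK K sign f) B.* (norm f (τ (embed x)) B.* N y)
        ≈⟨ B.*-cong (B.trans (ι-cong (sign-power m)) ι-1)
             (B.*-congʳ (B.sym (norm-natural (ψ-hom a a′ a-unit) (ψ-comm a β′) f (embed x)))) ⟩
      B.1# B.* (τ (N x) B.* N y)
        ≈⟨ B.*-identityˡ _ ⟩
      τ (N x) B.* N y
        ≈⟨ B.*-cong (B.trans (ψ-cong a (InV⇒scalar inV-x)) (ψ-ι a a′ a-unit _)) (InV⇒scalar inV-y) ⟩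
      ι (hForm K f l e γ x) B.* ι (hForm K f l e γ y)
        ≈⟨ ι-* _ _ ⟨
      ι (hForm K f l e γ x * hForm K f l e γ y) ∎
      where
      open SetoidReasoning B.setoid
      a a′ : ℕ
      a = r ℕ.* dinv
      a′ = r ℕ.* d
      a-unit : a ℕ.* a′ ≋ 1
      a-unit = ≋-trans (≡⇒≋ (regroup r dinv d)) (≋-trans (neg-neg (d ℕ.* dinv)) dinv-unit)
        where
        regroup : ∀ r u d → r ℕ.* u ℕ.* (r ℕ.* d) ≡ r ℕ.* (r ℕ.* (d ℕ.* u))
        regroup = solve-∀
      τ : Element → Element
      τ = ψ a

    phi-multiplicative : MultiplicativeVia K f l e γ (phi K f l dinv)
    phi-multiplicative = phi-bilinear ,
      (λ x y inV-x inV-y → scalar⇒InV {phi K f l dinv x y} (norm-phi inV-x inV-y)) ,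
      (λ x y inV-x inV-y → sym (scalar⇒hForm {phi K f l dinv x y} (norm-phi inV-x inV-y)))

-- Regularity of h.

module Regularity {c ℓ} (K : CommutativeRing c ℓ) (r e m γ : ℕ) (r≡ef : r ≡ e ℕ.* suc m)
  (prime : Prime (suc r)) (generator : IsGeneratorMod (suc r) γ) where
  open CommutativeRing K hiding (zero)
  open FiniteSums K
  open Residues r
  open PeriodicSums K
  open Cyclotomic K r
  open PrimitiveRoot r γ prime generator
  open Coordinates K r
  open NormForm K r e m γ r≡ef prime generator
  open Integrality K r using (no-zero-divisors)
  open SemiringMult semiring using () renaming (_×_ to _·_)
  open SemiringMult B.semiring using () renaming (_×_ to _·ᴮ_)
  open CommSemigroup B.*-commutativeSemigroup using () renaming (x∙yz≈y∙xz to *ᴮ-x∙yz≈y∙xz)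
  open RingProperties ring using (-0#≈0#)

  ·-natK : ∀ n x → n · x ≈ natK K n * x
  ·-natK zero x = sym (zeroˡ x)
  ·-natK (suc n) x = trans (+-cong (sym (*-identityˡ x)) (·-natK n x)) (sym (distribʳ x _ _))

  ·ᴮ-natK : ∀ n p → n ·ᴮ p ≈ᴮ ι (natK K n) B.* p
  ·ᴮ-natK zero p = B.sym (B.trans (B.*-congʳ ι-0) (B.zeroˡ p))
  ·ᴮ-natK (suc n) p = B.trans
    (B.+-cong (B.sym (B.trans (B.*-congʳ ι-1) (B.*-identityˡ p))) (·ᴮ-natK n p))
    (B.trans (B.sym (B.distribʳ p _ _)) (B.*-congʳ (B.sym (ι-+ _ _))))

  natK-+ : ∀ a b → natK K (a ℕ.+ b) ≈ natK K a + natK K b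
  natK-+ zero b = sym (+-identityˡ _)
  natK-+ (suc a) b = trans (+-congˡ (natK-+ a b)) (sym (+-assoc _ _ _))

  natK-* : ∀ a b → natK K (a ℕ.* b) ≈ natK K a * natK K b
  natK-* zero b = sym (zeroˡ _)
  natK-* (suc a) b = trans (natK-+ b (a ℕ.* b)) (trans
    (+-cong (sym (*-identityˡ _)) (natK-* a b)) (sym (distribʳ _ _ _)))

  -- By orthogonality of the characters i ↦ ζ^{ai}, this isolates the terms of
  -- perm v in which v k = ζ^i appears conjugated to ζ^{-ci}.
  projection : ℕ → ∀ n → (ℕ → Fin n → Element) → Element
  projection c n v = Sumᴮ.∑ l (λ i → ζ^ (c ℕ.* toℕ i) B.* perm n (v (toℕ i)))

  private
    off-punch : ∀ {n} {i k : Fin (suc n)} (i≢k : i ≢ k) {j} → j ≢ punchOut i≢k → punchIn i j ≢ k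
    off-punch {i = i} i≢k j≢ eq = j≢ (punchIn-injective i _ _ (≡.trans eq (≡.sym (punchIn-punchOut i≢k))))

    ζ-rescale : ∀ c i → ζ^ (c ℕ.* i) ≈ᴮ ψ β′ (ζ^ (β′ ℕ.* c ℕ.* i))
    ζ-rescale c i = B.sym (B.trans (ψ-ζ^ β′ β β-unit _) (ζ^-≋
      (≋-trans (≡⇒≋ (≡.cong (β ℕ.*_) (ℕ.*-assoc β′ c i))) (unit-cancel β β′ (unit-swap β′ β β-unit) _))))

  -- Expand along the unconjugated column. Choosing slot k gives the factor Σ ζ^{(c+1)i}. Any other
  -- chosen entry is independent of i, and ζ^{ci} = σ(ζ^{β′ci}) moves under σ, leaving a projection
  -- with exponent β′c and one slot fewer. Its vanishing is a hypothesis, so that the splitting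
  -- serves both when the factor is 0 and when it is l.
  projection-split : ∀ n k c v →
    (∀ i → v i k ≈ᴮ ζ^ i) → (∀ i j → j ≢ k → v i j ≈ᴮ v 0 j) →
    (∀ k′ v′ → (∀ i → v′ i k′ ≈ᴮ ζ^ i) → (∀ i j → j ≢ k′ → v′ i j ≈ᴮ v′ 0 j) →
       projection (β′ ℕ.* c) n v′ ≈ᴮ 0ᴮ) →
    projection c (suc n) v
    ≈ᴮ Sumᴮ.∑ l (λ i → ζ^ (suc c ℕ.* toℕ i)) B.* ψ β′ (perm n (v 0 ∘ punchIn k))
  projection-split n k c v at-k off-k vanishing = begin
    projection c (suc n) v
      ≈⟨ B.trans (Sumᴮ.∑-cong λ i → Sumᴮ.*-∑ _) Sumᴮ.∑-comm ⟩
    Sumᴮ.∑ (suc n) (λ j → Sumᴮ.∑ l (λ i → term j (toℕ i)))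
      ≈⟨ Sumᴮ.∑-single k other ⟩
    Sumᴮ.∑ l (λ i → term k (toℕ i))
      ≈⟨ Sumᴮ.∑-cong (λ i → B.trans (B.*-congˡ {ζ^ (c ℕ.* toℕ i)} (B.*-cong (at-k (toℕ i))
           (σ-cong (perm-cong n λ j → off-k (toℕ i) _ (punchInᵢ≢i k j)))))
           (B.trans (B.sym (B.*-assoc _ _ _)) (B.*-congʳ (B.trans (B.sym (ζ^-+ _ _))
             (B.reflexive (≡.cong ζ^ (ℕ.+-comm (c ℕ.* toℕ i) (toℕ i)))))))) ⟩
    Sumᴮ.∑ l (λ i → ζ^ (suc c ℕ.* toℕ i) B.* ψ β′ (perm n (v 0 ∘ punchIn k)))
      ≈⟨ Sumᴮ.∑-* _ ⟨
    Sumᴮ.∑ l (λ i → ζ^ (suc c ℕ.* toℕ i)) B.* ψ β′ (perm n (v 0 ∘ punchIn k)) ∎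
    where
    open SetoidReasoning B.setoid
    term : Fin (suc n) → ℕ → Element
    term j i = ζ^ (c ℕ.* i) B.* (v i j B.* ψ β′ (perm n (v i ∘ punchIn j)))
    other : ∀ j → j ≢ k → Sumᴮ.∑ l (λ i → term j (toℕ i)) ≈ᴮ 0ᴮ
    other j j≢k = begin
      Sumᴮ.∑ l (λ i → term j (toℕ i))
        ≈⟨ Sumᴮ.∑-cong (λ i → B.trans (*ᴮ-x∙yz≈y∙xz _ _ _) (B.*-cong (off-k (toℕ i) j j≢k)
             (B.trans (B.*-congʳ (ζ-rescale c (toℕ i))) (B.sym (σ-* _ _))))) ⟩
      Sumᴮ.∑ l (λ i → v 0 j B.* ψ β′ (ζ^ (β′ ℕ.* c ℕ.* toℕ i) B.* perm n (v (toℕ i) ∘ punchIn j)))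
        ≈⟨ B.trans (B.sym (Sumᴮ.*-∑ (v 0 j))) (B.*-congˡ {v 0 j} (B.sym σ-∑)) ⟩
      v 0 j B.* ψ β′ (projection (β′ ℕ.* c) n (λ i → v i ∘ punchIn j))
        ≈⟨ B.*-congˡ {v 0 j} (σ-cong (vanishing (punchOut j≢k) (λ i → v i ∘ punchIn j)
             (λ i → B.trans (B.reflexive (≡.cong (v i) (punchIn-punchOut j≢k))) (at-k i))
             (λ i j′ j′≢ → off-k i _ (off-punch j≢k j′≢)))) ⟩
      v 0 j B.* ψ β′ 0ᴮ
        ≈⟨ B.trans (B.*-congˡ {v 0 j} σ-0) (B.zeroʳ (v 0 j)) ⟩
      0ᴮ ∎

  private
    step-exponent : ∀ c j → β′ ℕ.* c ℕ.+ β ^ j ≋ 0 → c ℕ.+ β ^ suc j ≋ 0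
    step-exponent c j eq = ≋-trans (≋-sym (≋-trans (≡⇒≋ (ℕ.*-distribˡ-+ β (β′ ℕ.* c) (β ^ j)))
      (+-≋ (unit-cancel β β′ (unit-swap β′ β β-unit) c) ≋-refl))) (*-≋0 β eq)

  -- A slot ζⁱ conjugated by σʲ contributes Σ ζ^{(c+βʲ)i}, a geometric sum with unit exponent for
  -- each j that occurs.
  projection-vanishes : ∀ n k c v →
    (∀ i → v i k ≈ᴮ ζ^ i) → (∀ i j → j ≢ k → v i j ≈ᴮ v 0 j) →
    (∀ j → j ℕ.< n → ¬ c ℕ.+ β ^ j ≋ 0) → projection c n v ≈ᴮ 0ᴮ
  projection-vanishes (suc n) k c v at-k off-k avoids = B.trans
    (projection-split n k c v at-k off-k λ k′ v′ at off → projection-vanishes n k′ (β′ ℕ.* c) v′ at off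
      λ j j<n → avoids (suc j) (s≤s j<n) ∘ step-exponent c j)
    (B.trans (B.*-congʳ (geometric-sum (suc c) _ (proj₂ (inverse suc-c≢0)))) (B.zeroˡ _))
    where
    suc-c≢0 : ¬ suc c ≋ 0
    suc-c≢0 eq = avoids 0 (s≤s z≤n) (≋-trans (≡⇒≋ (ℕ.+-comm c 1)) eq)

  private
    β^j≢1 : ∀ {j} → suc j ℕ.< f → ¬ β ^ suc j ≋ 1
    β^j≢1 {j} j<f eq = order-minimal (e ℕ.* suc j)
      (ℕ.*-mono-≤ 0<e (s≤s (z≤n {j})))
      (ℕ.≤-trans (ℕ.*-monoʳ-< e {{ℕ.>-nonZero 0<e}} j<f) (ℕ.≤-reflexive (≡.sym r≡ef)))
      (≋-trans (≡⇒≋ (≡.sym (ℕ.^-*-assoc γ e (suc j)))) eq)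

    -1+x≋0⇒x≋1 : ∀ {x} → r ℕ.+ x ≋ 0 → x ≋ 1
    -1+x≋0⇒x≋1 {x} eq = ≋-trans (≋-sym (neg-cancel x 1)) (≋-trans (≡⇒≋ (regroup x r)) (+-≋ (≋-refl {1}) eq))
      where
      regroup : ∀ x r → x ℕ.+ (1 ℕ.+ r ℕ.* 1) ≡ 1 ℕ.+ (r ℕ.+ x)
      regroup = solve-∀

  -- Projecting the slot after U onto its unconjugated part yields l σ(perm(U, w)) with one slot
  -- fewer. Since l is invertible and σ injective, the hypothesis descends until the permanent is U
  -- itself.
  perm-nondegenerate : ∀ {l⁻¹} → natK K l * l⁻¹ ≈ 1# → ∀ {U} n → n ℕ.< f →
    (∀ (w : Fin n → Element) → perm (suc n) (U ∷ w) ≈ᴮ 0ᴮ) → U ≈ᴮ 0ᴮ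
  perm-nondegenerate inv {U} zero _ zeros = begin
    U                          ≈⟨ B.trans (B.*-congˡ {U} σ-1) (B.*-identityʳ U) ⟨
    U B.* ψ β′ 1ᴮ              ≈⟨ Sumᴮ.∑-single Fin.zero (λ { Fin.zero 0≢0 → contradiction ≡.refl 0≢0 ; (Fin.suc ()) _ }) ⟨
    perm 1 (U ∷ λ ())          ≈⟨ zeros (λ ()) ⟩
    0ᴮ                         ∎
    where open SetoidReasoning B.setoid
  perm-nondegenerate inv {U} (suc n) n<f zeros =
    perm-nondegenerate inv n (ℕ.<-trans (ℕ.n<1+n n) n<f) λ w →
      ψ-injective₀ β′ β β-unit (ι-cancel inv (B.trans (B.sym (extract w)) (all-zero w)))
    where
    open SetoidReasoning B.setoid
    v : (Fin n → Element) → ℕ → Fin (suc (suc n)) → Element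
    v w i = U ∷ (ζ^ i ∷ w)
    k : Fin (suc (suc n))
    k = Fin.suc Fin.zero
    all-zero : ∀ w → projection r (suc (suc n)) (v w) ≈ᴮ 0ᴮ
    all-zero w = B.trans (Sumᴮ.∑-cong λ i → B.trans (B.*-congˡ {ζ^ _} (zeros (ζ^ (toℕ i) ∷ w))) (B.zeroʳ _)) (Sumᴮ.∑-0 l)
    off : ∀ w i j → j ≢ k → v w i j ≈ᴮ v w 0 j
    off w i Fin.zero _ = B.refl
    off w i (Fin.suc Fin.zero) j≢k = contradiction ≡.refl j≢k
    off w i (Fin.suc (Fin.suc j)) _ = B.refl
    rest : ∀ w j → v w 0 (punchIn k j) ≈ᴮ (U ∷ w) j
    rest w Fin.zero = B.refl
    rest w (Fin.suc j) = B.refl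
    extract : ∀ w → projection r (suc (suc n)) (v w) ≈ᴮ ι (natK K l) B.* ψ β′ (perm (suc n) (U ∷ w))
    extract w = begin
      projection r (suc (suc n)) (v w)
        -- The exponent `r` stands for -1. A conjugated slot then has exponent βʲ - 1 with 0 < j <
        -- f, which is nonzero because γ has order r = ef.
        ≈⟨ projection-split (suc n) k r (v w) (λ i → B.refl) (off w) (λ k′ v′ at off′ →
             projection-vanishes (suc n) k′ (β′ ℕ.* r) v′ at off′ λ j j<n eq →
               β^j≢1 (ℕ.≤-<-trans j<n n<f) (-1+x≋0⇒x≋1 (step-exponent r j eq))) ⟩
      Sumᴮ.∑ l (λ i → ζ^ (l ℕ.* toℕ i)) B.* ψ β′ (perm (suc n) (v w 0 ∘ punchIn k))
        ≈⟨ B.*-cong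
             (B.trans (Sumᴮ.∑-cong λ i → ζ^-≋ (≋-trans (≡⇒≋ (ℕ.*-comm l (toℕ i))) (l≋0 (toℕ i))))
               (B.trans (Sumᴮ.∑-const l) (B.trans (·ᴮ-natK l 1ᴮ) (B.*-identityʳ _))))
             (σ-cong (perm-cong (suc n) (rest w))) ⟩
      ι (natK K l) B.* ψ β′ (perm (suc n) (U ∷ w)) ∎

  functional-0 : functional γ 0ᴮ ≈ 0#
  functional-0 = trans (+-cong (reflexive (coeff-0 0)) (-‿cong (reflexive (coeff-0 γ)))) (-‿inverseʳ 0#)

  functional-∑ : ∀ n (g : Fin n → Element) → functional γ (Sumᴮ.∑ n g) ≈ ∑[ i < n ] functional γ (g i)
  functional-∑ zero g = trans (functional-cong γ (B.reflexive Sumᴮ.∑-zero))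
    (trans functional-0 (sym (reflexive ∑-zero)))
  functional-∑ (suc n) g = trans (functional-cong γ (B.reflexive Sumᴮ.∑-suc))
    (trans (functional-+ γ _ _) (trans (+-congˡ (functional-∑ n (g ∘ Fin.suc))) (sym (reflexive ∑-suc))))

  -- The trace of 1 - ζ^{-γ} down to the fixed field of σ.
  discriminator : Element
  discriminator = Sumᴮ.∑ f (λ k → 1ᴮ B.- ζ^ (r ℕ.* (β′ ^ toℕ k ℕ.* γ)))

  private
    coeff-- : ∀ p q t → coeff (p B.- q) t ≈ coeff p t - coeff q t
    coeff-- p q t = trans (reflexive (coeff-+ p (B.- q) t)) (+-congˡ (reflexive (coeff-neg q t)))

  -- Take s to be the trace of ζⁱ. As P is fixed, λ(s P) is the sum over k of λ(σᵏ(ζⁱ P)), which is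
  -- exactly the coefficient of `discriminator` times P at -i. So all these coefficients vanish.
  discriminator-kills : ∀ {P} → ψ β′ P ≈ᴮ P →
    (∀ s → ψ β′ s ≈ᴮ s → functional γ (s B.* P) ≈ 0#) → discriminator B.* P ≈ᴮ 0ᴮ
  discriminator-kills {P} fixed orthogonal = B.trans
    (B.trans (Sumᴮ.∑-* P) (Sumᴮ.∑-cong λ k → B.trans (B.distribʳ P _ _)
      (B.+-cong (B.*-identityˡ P) (B.sym (-‿distribˡ-* _ P)))))
    (≐⇒≈ᴮ λ t → trans (coeff-∑ f _ t) (trans
      (∑-cong λ k → trans (coeff-- P _ t) (+-cong (shifted t) (-‿cong (trans (ζ^-* _ P t) (shifted′ t _)))))
      (trans (trace-vanishes (r ℕ.* t)) (sym (reflexive (coeff-0 t))))))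
    where
    open RingProperties B.ring using (-‿distribˡ-*)
    open SetoidReasoning setoid
    -- Indices t are written as -(-t) to match the coefficient at -i for i = -t.
    shifted : ∀ t → coeff P t ≈ coeff P (r ℕ.* (r ℕ.* t))
    shifted t = periodic P (≋-sym (neg-neg t))
    shifted′ : ∀ t a → coeff P (t ℕ.+ r ℕ.* (r ℕ.* a)) ≈ coeff P (a ℕ.+ r ℕ.* (r ℕ.* t))
    shifted′ t a = periodic P (≋-trans (+-≋ (≋-refl {t}) (neg-neg a))
      (≋-trans (≡⇒≋ (ℕ.+-comm t a)) (+-≋ (≋-refl {a}) (≋-sym (neg-neg t)))))
    trace-vanishes : ∀ i → ∑[ k < f ] (coeff P (r ℕ.* i) - coeff P (β′ ^ toℕ k ℕ.* γ ℕ.+ r ℕ.* i)) ≈ 0#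
    trace-vanishes i = begin
      ∑[ k < f ] (coeff P (r ℕ.* i) - coeff P (β′ ^ toℕ k ℕ.* γ ℕ.+ r ℕ.* i))
        ≈⟨ ∑-cong (λ k → trans (functional-cong γ (σ^-ψ (toℕ k) (ζ^ i B.* P)))
             (+-cong (trans (reflexive (coeff-ψ (β′ ^ toℕ k) _ 0)) (trans (ζ^-* i P _)
                       (reflexive (≡.cong (λ j → coeff P (j ℕ.+ r ℕ.* i)) (ℕ.*-zeroʳ (β′ ^ toℕ k))))))
                     (-‿cong (trans (reflexive (coeff-ψ (β′ ^ toℕ k) _ γ)) (ζ^-* i P _))))) ⟨
      ∑[ k < f ] functional γ (σ^ (toℕ k) (ζ^ i B.* P))
        ≈⟨ functional-∑ f _ ⟨
      functional γ (trace f (ζ^ i B.* P))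
        ≈⟨ functional-cong γ (trace-*-fixed f (ζ^ i) fixed) ⟨
      functional γ (trace f (ζ^ i) B.* P)
        ≈⟨ orthogonal _ (trace-invariant f (ζ^ i) (σ^f≈id _)) ⟩
      0# ∎

  module _ (field′ : IsField K) (char-f! : CharNotDivides K (f !)) (char-l : CharNotDivides K l)
    (irreducible : CyclotomicIrreducible K l) where

    private
      invert : ∀ {x} → ¬ x ≈ 0# → ∃ λ y → x * y ≈ 1#
      invert = proj₂ field′ _

      cancel : ∀ {x y z} → x * y ≈ 1# → x * z ≈ 0# → z ≈ 0#
      cancel {x} {y} {z} xy≈1 xz≈0 = trans (sym (*-identityˡ z)) (trans
        (*-congʳ (trans (sym xy≈1) (*-comm x y))) (trans (*-assoc y x z) (trans (*-congˡ xz≈0) (zeroʳ y))))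

    1ᴮ≉0ᴮ : ¬ 1ᴮ ≈ᴮ 0ᴮ
    1ᴮ≉0ᴮ (differBy d eq) = proj₁ field′ (trans (sym (δ-true (≋-refl {0})))
      (trans (at 0) (trans (sym (at 1)) (δ-false 1≢0))))
      where
      at : ∀ t → δ t 0 ≈ d
      at t = trans (reflexive (≡.sym (coeff-ζ^ 0 t)))
        (trans (eq t) (trans (+-congʳ (reflexive (coeff-0 t))) (+-identityˡ d)))

    natK-f≉0 : ¬ natK K f ≈ 0#
    natK-f≉0 eq = char-f! (trans (natK-* f (m !)) (trans (*-congʳ eq) (zeroˡ _)))

    -- The coefficients of the discriminator sum to 0, and the 0-th one is f.
    discriminator≉0 : ¬ discriminator ≈ᴮ 0ᴮ
    discriminator≉0 (differBy d eq) = natK-f≉0 (begin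
      natK K f                                  ≈⟨ trans (sym (*-identityʳ _)) (sym (·-natK f 1#)) ⟩
      f · 1#                                    ≈⟨ ∑-const f ⟨
      ∑[ k < f ] 1#                             ≈⟨ ∑-cong (λ k → trans (sym (+-identityʳ 1#)) (+-cong
                                                     (sym (δ-true (≋-refl {0}))) (trans (sym -0#≈0#)
                                                     (-‿cong (sym (δ-false (a≢0 k ∘ ≋-sym))))))) ⟩
      ∑[ k < f ] (δ 0 0 - δ 0 (a k))            ≈⟨ coeff-discriminator 0 ⟨
      coeff discriminator 0                     ≈⟨ at 0 ⟩
      d                                         ≈⟨ d≈0 ⟩
      0#                                        ∎)
      where
      open SetoidReasoning setoid
      a : Fin f → ℕ
      a k = r ℕ.* (β′ ^ toℕ k ℕ.* γ)
      a≢0 : ∀ k → ¬ a k ≋ 0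
      a≢0 k a≋0 with *≋0⇒ (β′ ^ toℕ k) γ (≋-trans (≋-sym (neg-neg _)) (*-≋0 r a≋0))
      ... | inj₂ γ≋0 = γ≢0 γ≋0
      ... | inj₁ eq′ = ^≢0 (e ℕ.* m ℕ.* toℕ k) (≋-trans (≡⇒≋ (≡.sym (≡.trans
              (≡.cong (_^ toℕ k) (ℕ.^-*-assoc γ e m)) (ℕ.^-*-assoc γ (e ℕ.* m) (toℕ k))))) eq′)
      at : ∀ t → coeff discriminator t ≈ d
      at t = trans (eq t) (trans (+-congʳ (reflexive (coeff-0 t))) (+-identityˡ d))
      coeff-discriminator : ∀ t → coeff discriminator t ≈ ∑[ k < f ] (δ t 0 - δ t (a k))
      coeff-discriminator t = trans (coeff-∑ f _ t) (∑-cong λ k → trans (coeff-- 1ᴮ (ζ^ (a k)) t)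
        (+-cong (reflexive (coeff-ζ^ 0 t)) (-‿cong (reflexive (coeff-ζ^ (a k) t)))))
      ∑-δ : ∀ b → ∑[ t < l ] δ (toℕ t) b ≈ 1#
      ∑-δ b = trans (∑-single (residue b) λ t t≢ → δ-false λ t≋b →
        t≢ (toℕ-≋-injective (≋-trans t≋b (≋-sym (residue-≋ b))))) (δ-true (residue-≋ b))
      ∑-neg : ∀ {n} (g : Fin n → Carrier) → ∑[ t < n ] (- g t) ≈ - ∑ n g
      ∑-neg g = trans (∑-cong λ t → sym (-1*x≈-x (g t))) (trans (sym (*-∑ (- 1#))) (-1*x≈-x _))
        where open RingProperties ring using (-1*x≈-x)
      l·d≈0 : natK K l * d ≈ 0#
      l·d≈0 = begin
        natK K l * d                                        ≈⟨ ·-natK l d ⟨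
        l · d                                               ≈⟨ ∑-const l ⟨
        ∑[ t < l ] d                                        ≈⟨ ∑-cong (λ t → trans (sym (coeff-discriminator (toℕ t))) (at (toℕ t))) ⟨
        ∑[ t < l ] ∑[ k < f ] (δ (toℕ t) 0 - δ (toℕ t) (a k)) ≈⟨ ∑-comm ⟩
        ∑[ k < f ] ∑[ t < l ] (δ (toℕ t) 0 - δ (toℕ t) (a k))
          ≈⟨ ∑-cong (λ k → trans ∑-+ (trans (+-cong (∑-δ 0) (trans (∑-neg _) (-‿cong (∑-δ (a k))))) (-‿inverseʳ 1#))) ⟩
        ∑[ k < f ] 0#                                       ≈⟨ ∑-0 f ⟩
        0#                                                  ∎
      d≈0 : d ≈ 0#
      d≈0 = cancel (proj₂ (invert char-l)) l·d≈0

    -- Equality is not decidable, so a cancellation needs an actual inverse: the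
    -- norm of D down to K is a scalar which is not zero, hence invertible in K.
    nonzero-cancels : ∀ {D P} → ¬ D ≈ᴮ 0ᴮ → D B.* P ≈ᴮ 0ᴮ → P ≈ᴮ 0ᴮ
    nonzero-cancels {D} {P} D≉0 DP≈0 = ι-cancel (proj₂ (invert n≉0))
      (B.trans (B.*-congʳ (B.sym norm-scalar)) norm-kills)
      where
      γ′ : ℕ
      γ′ = proj₁ (inverse γ≢0)
      module G = Permanent cyclotomicRing (ψ γ) (ψ-hom γ γ′ (proj₂ (inverse γ≢0)))
      G-σ^ : ∀ n p → G.σ^ n p ≈ᴮ ψ (γ ^ n) p
      G-σ^ zero p = B.sym (ψ-1 p)
      G-σ^ (suc n) p = B.trans (G.σ-cong (G-σ^ n p)) (ψ-∘ γ (γ ^ n) p)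
      invariant : ∀ t → coeff (G.norm r D) (γ ℕ.* t) ≈ coeff (G.norm r D) t
      invariant = ψ-fixed-coeff γ (G.norm-invariant r D
        (B.trans (G-σ^ r D) (B.trans (ψ-≋ γ^r≋1 D) (ψ-1 D))))
      powers : ∀ k → coeff (G.norm r D) (γ ^ k) ≈ coeff (G.norm r D) 1
      powers zero = refl
      powers (suc k) = trans (invariant (γ ^ k)) (powers k)
      n : Carrier
      n = functional γ (G.norm r D)
      norm-scalar : G.norm r D ≈ᴮ ι n
      norm-scalar = scalar-if-constant-off-0 λ t t≢0 → trans
        (periodic (G.norm r D) (≋-sym (proj₂ (logarithm t≢0)))) (trans (powers (proj₁ (logarithm t≢0)))
        (trans (sym (powers 1)) (periodic (G.norm r D) (≡⇒≋ (ℕ.*-identityʳ γ)))))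
      norm≉0 : ∀ k → ¬ G.norm k D ≈ᴮ 0ᴮ
      norm≉0 zero = 1ᴮ≉0ᴮ
      norm≉0 (suc k) eq = no-zero-divisors field′ irreducible eq D≉0
        (norm≉0 k ∘ ψ-injective₀ γ γ′ (proj₂ (inverse γ≢0)))
      n≉0 : ¬ n ≈ 0#
      n≉0 n≈0 = norm≉0 r (B.trans norm-scalar (B.trans (ι-cong n≈0) ι-0))
      norm-kills : G.norm r D B.* P ≈ᴮ 0ᴮ
      norm-kills = B.trans (B.*-congʳ (B.reflexive (≡.cong (λ k → G.norm k D)
        (≡.sym (ℕ.suc-pred r {{ℕ.>-nonZero 0<r}}))))) (B.trans (B.*-congʳ (B.*-comm D _))
        (B.trans (B.*-assoc _ D P) (B.trans (B.*-congˡ {ψ γ (G.norm (ℕ.pred r) D)} DP≈0) (B.zeroʳ _))))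

    private
      1/f! : Carrier
      1/f! = proj₁ (invert char-f!)

      embed-axpy : ∀ a u w → embed (axpy K a u w) ≈ᴮ ι a B.* embed u B.+ embed w
      embed-axpy a u w = ≐⇒≈ᴮ λ t → trans (embed-linear a u w t)
        (trans (+-congʳ (sym (ι-*ᴮ a (embed u) t))) (reflexive (≡.sym (coeff-+ (ι a B.* embed u) (embed w) t))))

      update-same : ∀ {n} (v : Fin n → Vec K r) j u → update K v j u j ≡ u
      update-same v j u with j Fin.≟ j
      ... | yes _ = ≡.refl
      ... | no j≢j = contradiction ≡.refl j≢j

      update-other : ∀ {n} (v : Fin n → Vec K r) j u {k} → k ≢ j → update K v j u k ≡ v k
      update-other v j u {k} k≢j with k Fin.≟ j
      ... | yes k≡j = contradiction k≡j k≢j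
      ... | no _ = ≡.refl

    θ : (Fin f → Vec K r) → Carrier
    θ v = 1/f! * functional γ (perm f (embed ∘ v))

    θ-multilinear : IsMultilinear K θ
    θ-multilinear v j a u w = begin
      1/f! * functional γ (perm f (embed ∘ update K v j (axpy K a u w)))
        ≈⟨ *-congˡ (functional-cong γ (perm-linear f j (ψ-ι β′ β β-unit a) _ _ _
             (B.trans (at-j (axpy K a u w)) (B.trans (embed-axpy a u w) (B.+-cong (B.*-congˡ {ι a} (B.sym (at-j u))) (B.sym (at-j w)))))
             (λ k k≢j → off-j _ u k≢j) (λ k k≢j → off-j _ w k≢j))) ⟩
      1/f! * functional γ (ι a B.* perm f (embed ∘ update K v j u) B.+ perm f (embed ∘ update K v j w))
        ≈⟨ *-congˡ (trans (functional-+ γ _ _) (+-congʳ (functional-ι* γ a _))) ⟩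
      1/f! * (a * functional γ (perm f (embed ∘ update K v j u)) + functional γ (perm f (embed ∘ update K v j w)))
        ≈⟨ trans (distribˡ _ _ _) (+-congʳ (*-x∙yz≈y∙xz _ _ _)) ⟩
      a * θ (update K v j u) + θ (update K v j w) ∎
      where
      open SetoidReasoning setoid
      open CommSemigroup *-commutativeSemigroup using () renaming (x∙yz≈y∙xz to *-x∙yz≈y∙xz)
      at-j : ∀ u → embed (update K v j u j) ≈ᴮ embed u
      at-j u = B.reflexive (≡.cong embed (update-same v j u))
      off-j : ∀ u u′ {k} → k ≢ j → embed (update K v j u k) ≈ᴮ embed (update K v j u′ k)
      off-j u u′ k≢j = B.reflexive (≡.cong embed
        (≡.trans (update-other v j u k≢j) (≡.sym (update-other v j u′ k≢j))))

    θ-symmetric : IsSymmetric K θ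
    θ-symmetric π v = *-congˡ (functional-cong γ (perm-permute f π (embed ∘ v)))

    hForm-θ : ∀ x → hForm K f l e γ x ≈ θ (λ _ → x)
    hForm-θ x = begin
      hForm K f l e γ x                                    ≈⟨ hForm-functional x ⟩
      functional γ (N x)                                   ≈⟨ *-identityˡ _ ⟨
      1# * functional γ (N x)                              ≈⟨ *-congʳ (trans (sym (proj₂ (invert char-f!))) (*-comm _ _)) ⟩
      1/f! * natK K (f !) * functional γ (N x)             ≈⟨ *-assoc _ _ _ ⟩
      1/f! * (natK K (f !) * functional γ (N x))           ≈⟨ *-congˡ (functional-ι* γ _ (N x)) ⟨
      1/f! * functional γ (ι (natK K (f !)) B.* N x)
        ≈⟨ *-congˡ (functional-cong γ (B.trans (perm-diagonal f (embed x)) (·ᴮ-natK (f !) (N x)))) ⟨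
      θ (λ _ → x)                                          ∎
      where open SetoidReasoning setoid

    -- Besides u there must be another slot, given by `0 ℕ.< m`, into which a fixed scalar s can be
    -- absorbed: that turns λ(P) = 0 for all permanents P into λ(s P) = 0.
    θ-nondegenerate : 0 ℕ.< m → ∀ u → (∀ w → θ (u ∷ w) ≈ 0#) → _≈ᵛ_ K u (zeroᵛ K)
    θ-nondegenerate 0<m u zeros = embed-injective₀ (perm-nondegenerate (proj₂ (invert char-l)) m (ℕ.n<1+n m)
      λ W → nonzero-cancels discriminator≉0 (discriminator-kills
        (perm-invariant f σ^f≈id (embed u ∷ W)) (orthogonal W)))
      where
      -- Every ring element is the class of its coordinate vector, so vanishing on vectors extends
      -- to arbitrary entries.
      functional-zero : ∀ W → functional γ (perm f (embed u ∷ W)) ≈ 0#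
      functional-zero W = trans (functional-cong γ (perm-cong f
          (λ { Fin.zero → B.refl ; (Fin.suc k) → B.sym (embed-≈ λ i → refl) })))
        (cancel {1/f!} (trans (*-comm _ _) (proj₂ (invert char-f!))) (zeros (coordinates ∘ W)))
      orthogonal : ∀ W s → ψ β′ s ≈ᴮ s → functional γ (s B.* perm f (embed u ∷ W)) ≈ 0#
      orthogonal W s fixed = begin
        functional γ (s B.* P)                       ≈⟨ +-identityʳ _ ⟨
        -- `perm-linear` speaks of s v₁ + v₂, so the slot is changed to s Wⱼ + Wⱼ; the additional
        -- summand λ(P) is 0.
        functional γ (s B.* P) + 0#                  ≈⟨ +-congˡ (functional-zero W) ⟨
        functional γ (s B.* P) + functional γ P      ≈⟨ functional-+ γ _ _ ⟨
        functional γ (s B.* P B.+ P)                 ≈⟨ functional-cong γ (perm-linear f (Fin.suc j) fixed _ _ _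
                                                          (at-j (j Fin.≟ j)) (λ k k≢ → off-j k k≢) (λ k k≢ → off-j k k≢)) ⟨
        functional γ (perm f (embed u ∷ W′))         ≈⟨ functional-zero W′ ⟩
        0#                                           ∎
        where
        open SetoidReasoning setoid
        P : Element
        P = perm f (embed u ∷ W)
        j : Fin m
        j = fromℕ< 0<m
        adjust : ∀ {k} → Dec (k ≡ j) → Element → Element
        adjust (yes _) p = s B.* p B.+ p
        adjust (no _) p = p
        W′ : Fin m → Element
        W′ k = adjust (k Fin.≟ j) (W k)
        at-j : (d : Dec (j ≡ j)) → adjust d (W j) ≈ᴮ s B.* W j B.+ W j
        at-j (yes _) = B.refl
        at-j (no j≢j) = contradiction ≡.refl j≢j
        off-j : ∀ k → k ≢ Fin.suc j → (embed u ∷ W′) k ≈ᴮ (embed u ∷ W) k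
        off-j Fin.zero _ = B.refl
        off-j (Fin.suc k) k≢ with k Fin.≟ j
        ... | yes ≡.refl = contradiction ≡.refl k≢
        ... | no _ = B.refl

    hForm-regular : 0 ℕ.< m → IsRegularForm K m (hForm K f l e γ)
    hForm-regular 0<m = θ , θ-multilinear , θ-symmetric , hForm-θ , θ-nondegenerate 0<m

open import Data.Nat using (_+_; _*_; _%_; _≤_; NonZero)
open import Data.Nat.Divisibility using (_∣_)

theorem1p5 : ∀ {c ℓ} (R : CommutativeRing c ℓ) → IsField R →
    (f e l γ : ℕ) → {{_ : NonZero l}} →
    2 ≤ f → Prime l → ¬ (2 ∣ l) → l ≡ e * f + 1 →
    CharNotDivides R (f !) → CharNotDivides R l →
    CyclotomicIrreducible R l →
    IsGeneratorMod l γ →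
    IsRegularForm R (f ∸ 1) (hForm R f l e γ)
    × Σ (Vec R (l ∸ 1) → Vec R (l ∸ 1) → Vec R (l ∸ 1)) (MultiplicativeVia R f l e γ)
    × (∀ (d dinv : ℕ) → ¬ (d % l ≡ 0) → (d * dinv) % l ≡ 1 →
         MultiplicativeVia R f l e γ (phi R f l dinv))
theorem1p5 R field′ (suc m) e (suc r) γ (s≤s 1≤m) l-prime _ l≡ef+1 char-f! char-l irreducible generator =
  hForm-regular field′ char-f! char-l irreducible 1≤m ,
  -- The witness for existence is φ_d with d = 1, its own inverse.
  (phi R (suc m) (suc r) 1 , phi-multiplicative 1 1 ≋-refl) ,
  λ d dinv _ eq → phi-multiplicative d dinv
    -- A congruence compares with `1 % l`, which is 1 because l exceeds 1.
    (congruent (≡.trans eq (≡.sym (m<n⇒m%n≡m (s≤s 0<r)))))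
  where
  r≡ef : r ≡ e * suc m
  r≡ef = ℕ.suc-injective (≡.trans l≡ef+1 (ℕ.+-comm (e * suc m) 1))
  open Residues r
  open NormForm R r e m γ r≡ef l-prime generator
  open Regularity R r e m γ r≡ef l-prime generator
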